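{- For every integer $n\ge2$ and all $k_1,\dots,k_n\in\mathbb{N}_0$, $$\zeta_{\mathrm{EMS}}(-k_1,\dots,-k_n)=\sum_{i_n+j_n=k_n}\binom{k_n}{i_n}\,\zeta_{\mathrm{EMS}}(-i_n)\,\zeta_{\mathrm{EMS}}(-k_1,\dots,-k_{n-2},-k_{n-1}-j_n)$$ (the sum over $i_n,j_n\in\mathbb{N}_0$), and $$\mathfrak{h}_{k_1,\dots,k_{n-1}}(x)=(-1)^{k_1+\cdots+k_{n-1}}\left(\mathfrak{h}\,\partial_x^{k_{n-1}}\right)\cdots\left(\mathfrak{h}\,\partial_x^{k_1}\right)(\mathfrak{h})$$ in $\mathbb{C}[[x]]$, where $\mathfrak{h}\,\partial_x^{k}$ denotes the operator $g\mapsto \mathfrak{h}\cdot\partial_x^{k}g$ on $\mathbb{C}[[x]]$.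
   Context: $\mathbb{N}_0=\{0,1,2,\dots\}$. **Generating functions.** In $\mathbb{C}[[x]]$, $$\mathfrak{h}=\mathfrak{h}(x):=\sum_{k=0}^\infty\frac{(-x)^k}{k!}\zeta_{\mathrm{EMS}}(-k),\qquad \mathfrak{h}_{k_1,\dots,k_{n-1}}(x):=\sum_{k_n=0}^\infty\frac{(-x)^{k_n}}{k_n!}\zeta_{\mathrm{EMS}}(-k_1,\dots,-k_n)\quad(n\ge2).$$ **Renormalized values.** Let $L=\{d,y\}$, let $L^*$ be the free monoid on $L$ with unit the empty word $\mathbf{1}$, and $\mathbb{Q}\langle L\rangle$ the $\mathbb{Q}$-span of $L^*$. Put $Y:=L^*y\cup\{\mathbf{1}\}$. Define a $\mathbb{Q}$-bilinear product $\sqcup\!\sqcup_0$ on $\mathbb{Q}\langle L\rangle$ recursively, for words $u,v,w\in L^*$, by $\mathbf 1\sqcup\!\sqcup_0 w=w\sqcup\!\sqcup_0\mathbf 1=w$; $\ yu\sqcup\!\sqcup_0 v=u\sqcup\!\sqcup_0 yv=y(u\sqcup\!\sqcup_0 v)$; $\ du\sqcup\!\sqcup_0 dv=d(u\sqcup\!\sqcup_0 dv)-u\sqcup\!\sqcup_0 d^2v$. Let $\mathcal{T}_-$ be the linear span of $\{wd\mid w\in L^*\}$; let $\mathcal{L}_-$ be the two-sided ideal of $(\mathbb{Q}\langle L\rangle,\sqcup\!\sqcup_0)$ generated by all $d^k\{d(u\sqcup\!\sqcup_0 v)-du\sqcup\!\sqcup_0 v-u\sqcup\!\sqcup_0 dv\}$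 with $k\in\mathbb{N}_0$, $u,v\in L^*$; put $\mathcal{S}_-:=\mathcal{T}_-+\mathcal{L}_-$ (a two-sided ideal) and $\mathcal{H}_0:=\mathbb{Q}\langle L\rangle/\mathcal{S}_-$. It is known (Ebrahimi-Fard–Manchon–Singer) that $\mathcal{H}_0$ is a connected filtered commutative and cocommutative Hopf algebra with product $\sqcup\!\sqcup_0$ and coproduct given, for $w=x_1\cdots x_N\in Y\setminus\{\mathbf 1\}$ ($x_i\in L$), by $\Delta_0(w)=\sum_{S}w_S\otimes w_{\overline S}$, the sum being over all $S\subset\{1,\dots,N\}$ (possibly empty) such that $w_S,w_{\overline S}\in Y$, where $\overline S$ is the complement of $S$ and $w_S:=x_{i_1}\cdots x_{i_r}$ for $S=\{i_1<\cdots<i_r\}$. The counit $\varepsilon$ satisfies $\varepsilon(\mathbf 1)=1$ and $\varepsilon(w)=0$ for $w\in Y\setminus\{\mathbf 1\}$. Let $\mathcal{A}:=\mathbb{Q}[[z]][\frac1z]=\mathcal{A}_-\oplus\mathcal{A}_+$ with $\mathcal{A}_-=\frac1z\mathbb{Q}[\frac1z]$, $\mathcal{A}_+=\mathbb{Q}[[z]]$. For linear maps $\alpha,\beta:\mathcal{H}_0\to\mathcal{A}$ the convolution is $\alpha*\beta:=m_{\mathcal{A}}\circ(\alpha\otimes\beta)\circ\Delta_0$; the linear maps with $\mathbf 1\mapsto1$ form a group under $*$. Let $\phi:\mathcal{H}_0\to\mathcal{A}$ be the linear map with $\phi(\mathbf 1)=1$ and $\phi(d^{k_1}y\cdots d^{k_n}y)(z)=\partial_z^{k_1}(\xi\partial_z^{k_2})\cdots(\xi\partial_z^{k_n})(\xi)$,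 $\xi=\xi(z)=\frac{e^z}{1-e^z}$ (known to be a well-defined algebra homomorphism). By the algebraic Birkhoff decomposition there are unique linear maps $\phi_+:\mathcal{H}_0\to\mathcal{A}_+$ and $\phi_-:\mathcal{H}_0\to\mathbb{Q}\oplus\mathcal{A}_-$ with $\phi_-(\mathbf 1)=1$, $\phi_-(\ker\varepsilon)\subset\mathcal{A}_-$ and $\phi=\phi_-^{ -1}*\phi_+$ (inverse with respect to $*$); both are algebra homomorphisms. The renormalized value is $$\zeta_{\mathrm{EMS}}(-k_1,\dots,-k_n):=\lim_{z\to0}\phi_+(d^{k_n}y\cdots d^{k_1}y)(z)\qquad(k_1,\dots,k_n\in\mathbb{N}_0).$$ -}

module Defs where

open import Algebra.Bundles using (CommutativeRing)
open import Algebra.Core using (Op₁; Op₂)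
open import Algebra.Module.Bundles.Raw using (RawLeftModule)
open import Algebra.Module.Morphism.Structures using (module LeftModuleMorphisms)
import Algebra.Properties.Ring as Ring
open import Data.Bool.Base using (if_then_else_)
open import Data.Empty using (⊥)
open import Data.Fin.Subset using (Subset; inside; outside; ∁)
open import Data.Integer.Base as ℤ using (ℤ; +_; -[1+_]; 0ℤ; -1ℤ)
import Data.Integer.Properties as ℤ
open import Data.List.Base
  using (List; []; _∷_; _++_; _∷ʳ_; [_]; map; concatMap; filter; foldl; foldr; length; replicate; reverse; initLast; _∷ʳ′_)
open import Data.List.Properties using (≡-dec; ∷ʳ-injectiveʳ)
open import Data.Nat.Base as ℕ using (ℕ; zero; suc; _!)
open import Data.Nat.Properties as ℕ using (_!≢0)
open import Data.Product.Base using (_×_; _,_; ∃₂; map₁; map₂)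
open import Data.Rational.Base as ℚ using (ℚ; 0ℚ; 1ℚ; _/_)
import Data.Rational.Properties as ℚ
open import Data.Vec.Base as Vec using (Vec; []; _∷_)
open import Function.Base using (_∘_)
open import Level using (Level; 0ℓ)
open import Relation.Binary.Definitions using (DecidableEquality)
open import Relation.Binary.PropositionalEquality
  using (_≡_; refl; sym; trans; cong; cong₂; module ≡-Reasoning)
open import Relation.Nullary.Decidable using (yes; no; does; _×-dec_)
open import Relation.Unary using (Decidable)

private
  variable
    a c ℓ : Level
    A : Set a

-- antidiagonalSum _+_ k f is the sum of f i j over all i, j ∈ ℕ with i + j ≡ k.
antidiagonalSum : Op₂ A → ℕ → (ℕ → ℕ → A) → A
antidiagonalSum _+_ zero    f = f 0 0
antidiagonalSum _+_ (suc k) f = f 0 (suc k) + antidiagonalSum _+_ k (λ i j → f (suc i) j)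

∑[i+j≡_] : ℕ → (ℕ → ℕ → ℚ) → ℚ
∑[i+j≡_] = antidiagonalSum ℚ._+_

infix 7.5 _/!_
_/!_ : ℤ → ℕ → ℚ
p /! n = p / (n !)
  where instance _ = n !≢0

------------------------------------------------------------------------
-- The algebra 𝒜 = ℚ[[z]][1/z]

-- z^- N · f stands for z^{-N} ∑ₙ f(n) zⁿ; f(0) may vanish, so representatives
-- are not unique.
infix 4 z^-_·_
record 𝒜 : Set where
  constructor z^-_·_
  field
    order     : ℕ
    numerator : ℕ → ℚ

open 𝒜

extend : (ℕ → ℚ) → ℤ → ℚ
extend f (+ n)    = f n
extend f -[1+ n ] = 0ℚ

-- The coefficient of zᵏ.
coeff : 𝒜 → ℤ → ℚ
coeff f k = extend (numerator f) (k ℤ.+ + order f)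

infix 4 _≈_
_≈_ : 𝒜 → 𝒜 → Set
f ≈ g = ∀ k → coeff f k ≡ coeff g k

infixl 6 _+_
infixl 7 _*_
infixr 7 _·_
infix  8 -_

_+_ : 𝒜 → 𝒜 → 𝒜
f + g = z^- N · λ n → coeff f (+ n ℤ.- + N) ℚ.+ coeff g (+ n ℤ.- + N)
  where N = order f ℕ.+ order g

_*_ : 𝒜 → 𝒜 → 𝒜
f * g = z^- order f ℕ.+ order g · λ n → ∑[i+j≡ n ] λ i j → numerator f i ℚ.* numerator g j

_·_ : ℚ → 𝒜 → 𝒜
c · f = z^- order f · λ n → c ℚ.* numerator f n

-_ : 𝒜 → 𝒜
- f = z^- order f · λ n → ℚ.- numerator f n

const : ℚ → 𝒜
const c = z^- 0 · λ { zero → c ; (suc _) → 0ℚ }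

0# 1# : 𝒜
0# = const 0ℚ
1# = const 1ℚ

∂ : 𝒜 → 𝒜
∂ f = z^- suc (order f) · λ n → ((+ n ℤ.- + order f) / 1) ℚ.* numerator f n

∂^ : ℕ → 𝒜 → 𝒜
∂^ zero    f = f
∂^ (suc k) f = ∂ (∂^ k f)

𝒜₊ 𝒜₋ ℚ⊕𝒜₋ : 𝒜 → Set
𝒜₊ f = ∀ k → coeff f -[1+ k ] ≡ 0ℚ
𝒜₋ f = ∀ k → coeff f (+ k) ≡ 0ℚ
ℚ⊕𝒜₋ f = ∃₂ λ c g → 𝒜₋ g × f ≈ const c + g

-- The limit as z → 0, meaningful for f ∈ 𝒜₊.
lim₀ : 𝒜 → ℚ
lim₀ f = coeff f 0ℤ

𝒜-rawLeftModule : RawLeftModule ℚ 0ℓ 0ℓ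
𝒜-rawLeftModule = record
  { Carrierᴹ = 𝒜 ; _≈ᴹ_ = _≈_ ; _+ᴹ_ = _+_ ; _*ₗ_ = _·_ ; 0ᴹ = 0# ; -ᴹ_ = -_ }

private
  dot : ∀ {n} → (ℕ → ℚ) → Vec ℚ n → ℚ
  dot e []       = 0ℚ
  dot e (q ∷ qs) = e 0 ℚ.* q ℚ.+ dot (e ∘ suc) qs

  -- The list [qₙ, …, q₀] of coefficients of the quotient f/e, computed from
  -- qₙ = f(n) − ∑_{i=1}^{n} e(i) qₙ₋ᵢ.
  quotients : (f e : ℕ → ℚ) (n : ℕ) → Vec ℚ (suc n)
  quotients f e zero    = f 0 ∷ []
  quotients f e (suc n) = (f (suc n) ℚ.- dot (e ∘ suc) qs) ∷ qs
    where qs = quotients f e n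

-- Division of power series, for a divisor with constant term 1.
quotient : (f e : ℕ → ℚ) → ℕ → ℚ
quotient f e n = Vec.head (quotients f e n)

exp : 𝒜
exp = z^- 0 · λ n → + 1 /! n

-- ξ = eᶻ / (1 − eᶻ), written as z⁻¹ · (− eᶻ / E) with E = (eᶻ − 1) / z = ∑ zⁿ / (n+1)!.
ξ : 𝒜
ξ = - (z^- 1 · quotient (λ n → + 1 /! n) (λ n → + 1 /! suc n))

private
  open Ring (CommutativeRing.ring ℚ.+-*-commutativeRing) using (-‿involutive)

  e E : ℕ → ℚ
  e n = + 1 /! n
  E n = + 1 /! suc n

  q : ℕ → ℚ
  q = quotient e E

  dot≡∑ : ∀ f n → dot f (quotients e E n) ≡ ∑[i+j≡ n ] λ i j → f i ℚ.* q j
  dot≡∑ f zero    = ℚ.+-identityʳ _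
  dot≡∑ f (suc n) = cong (f 0 ℚ.* q (suc n) ℚ.+_) (dot≡∑ (f ∘ suc) n)

  E*q≡e : ∀ n → (∑[i+j≡ n ] λ i j → E i ℚ.* q j) ≡ e n
  E*q≡e zero    = ℚ.*-identityˡ _
  E*q≡e (suc n) = begin
    1ℚ ℚ.* (e (suc n) ℚ.- s) ℚ.+ ∑[i+j≡ n ] (λ i j → E (suc i) ℚ.* q j)
      ≡⟨ cong₂ ℚ._+_ (ℚ.*-identityˡ (e (suc n) ℚ.- s)) (sym (dot≡∑ (E ∘ suc) n)) ⟩
    e (suc n) ℚ.- s ℚ.+ s           ≡⟨ ℚ.+-assoc (e (suc n)) (ℚ.- s) s ⟩
    e (suc n) ℚ.+ (ℚ.- s ℚ.+ s)     ≡⟨ cong (e (suc n) ℚ.+_) (ℚ.+-inverseˡ s) ⟩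
    e (suc n) ℚ.+ 0ℚ                ≡⟨ ℚ.+-identityʳ _ ⟩
    e (suc n)                       ∎
    where
    open ≡-Reasoning
    s = dot (E ∘ suc) (quotients e E n)

  ∑-cong : ∀ n {f g : ℕ → ℕ → ℚ} → (∀ i j → f i j ≡ g i j) → ∑[i+j≡ n ] f ≡ ∑[i+j≡ n ] g
  ∑-cong zero    f≡g = f≡g 0 0
  ∑-cong (suc n) f≡g = cong₂ ℚ._+_ (f≡g 0 (suc n)) (∑-cong n λ i j → f≡g (suc i) j)

  coeff-0 : ∀ f n → coeff (z^- 0 · f) (+ n ℤ.- + 0) ≡ f n
  coeff-0 f n = cong f (trans (ℕ.+-identityʳ (n ℕ.+ 0)) (ℕ.+-identityʳ n))

  1-eᶻ : 𝒜
  1-eᶻ = 1# + - exp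

  1-eᶻ-suc : ∀ n → numerator 1-eᶻ (suc n) ≡ ℚ.- E n
  1-eᶻ-suc n = trans (cong₂ ℚ._+_ (coeff-0 (numerator 1#) (suc n)) (coeff-0 (numerator (- exp)) (suc n)))
                     (ℚ.+-identityˡ _)

  -*- : ∀ x y → ℚ.- x ℚ.* ℚ.- y ≡ x ℚ.* y
  -*- x y = begin
    ℚ.- x ℚ.* ℚ.- y      ≡⟨ ℚ.neg-distribˡ-* x (ℚ.- y) ⟨
    ℚ.- (x ℚ.* ℚ.- y)    ≡⟨ ℚ.neg-distribʳ-* x (ℚ.- y) ⟩
    x ℚ.* ℚ.- (ℚ.- y)    ≡⟨ cong (x ℚ.*_) (-‿involutive y) ⟩
    x ℚ.* y              ∎
    where open ≡-Reasoning

ξ-spec : (1# + - exp) * ξ ≈ exp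
ξ-spec (+ n) rewrite ℕ.+-identityʳ n | ℕ.+-comm n 1 = begin
  0ℚ ℚ.* ℚ.- q (suc n) ℚ.+ ∑[i+j≡ n ] (λ i j → numerator 1-eᶻ (suc i) ℚ.* ℚ.- q j)
    ≡⟨ cong₂ ℚ._+_ (ℚ.*-zeroˡ (ℚ.- q (suc n)))
         (∑-cong n λ i j → trans (cong (ℚ._* ℚ.- q j) (1-eᶻ-suc i)) (-*- (E i) (q j))) ⟩
  0ℚ ℚ.+ ∑[i+j≡ n ] (λ i j → E i ℚ.* q j)
    ≡⟨ ℚ.+-identityˡ _ ⟩
  ∑[i+j≡ n ] (λ i j → E i ℚ.* q j)
    ≡⟨ E*q≡e n ⟩
  e n ∎
  where open ≡-Reasoning
ξ-spec -[1+ zero ]  = refl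
ξ-spec -[1+ suc n ] = refl

------------------------------------------------------------------------
-- Words and ℚ⟨L⟩

data Letter : Set where
  𝐝 𝐲 : Letter

_≟ᴸ_ : DecidableEquality Letter
𝐝 ≟ᴸ 𝐝 = yes refl
𝐝 ≟ᴸ 𝐲 = no λ ()
𝐲 ≟ᴸ 𝐝 = no λ ()
𝐲 ≟ᴸ 𝐲 = yes refl

Word : Set
Word = List Letter

data Y : Word → Set where
  𝟏  : Y []
  _y : ∀ w → Y (w ∷ʳ 𝐲)

private
  Y-last : ∀ {w} → Y w → ∀ u → w ≡ u ∷ʳ 𝐝 → ⊥
  Y-last 𝟏     []      ()
  Y-last 𝟏     (_ ∷ _) ()
  Y-last (v y) u eq with ∷ʳ-injectiveʳ v u eq
  ... | ()

Y? : Decidable Y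
Y? w with initLast w
... | []      = yes 𝟏
... | u ∷ʳ′ 𝐲 = yes (u y)
... | u ∷ʳ′ 𝐝 = no λ p → Y-last p u refl

-- The word d^{k₁}y ⋯ d^{kₙ}y.
dy : List ℕ → Word
dy []       = []
dy (k ∷ ks) = replicate k 𝐝 ++ 𝐲 ∷ dy ks

-- Formal linear combinations, with repetitions and zero coefficients allowed;
-- _≋_ below is equality in the free module.
ℚ⟨L⟩ : Set
ℚ⟨L⟩ = List (ℚ × Word)

coeffᵂ : ℚ⟨L⟩ → Word → ℚ
coeffᵂ []            w = 0ℚ
coeffᵂ ((c , u) ∷ p) w = (if does (≡-dec _≟ᴸ_ u w) then c else 0ℚ) ℚ.+ coeffᵂ p w

infix 4 _≋_
_≋_ : ℚ⟨L⟩ → ℚ⟨L⟩ → Set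
p ≋ q = ∀ w → coeffᵂ p w ≡ coeffᵂ q w

infixl 6 _⊕_ _⊖_
infixr 7 _•_
infixl 7 _⧢₀_ _⧢_

⟨_⟩ : Word → ℚ⟨L⟩
⟨ w ⟩ = [ (1ℚ , w) ]

_⊕_ : Op₂ ℚ⟨L⟩
_⊕_ = _++_

_•_ : ℚ → ℚ⟨L⟩ → ℚ⟨L⟩
c • p = map (map₁ (c ℚ.*_)) p

⊝_ : Op₁ ℚ⟨L⟩
⊝ p = map (map₁ (λ c → ℚ.- c)) p

_⊖_ : Op₂ ℚ⟨L⟩
p ⊖ q = p ⊕ ⊝ q

linear : (Word → ℚ⟨L⟩) → ℚ⟨L⟩ → ℚ⟨L⟩
linear f = concatMap λ (c , w) → c • f w

infixr 8 _◃_
_◃_ : Letter → ℚ⟨L⟩ → ℚ⟨L⟩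
x ◃ p = map (map₂ (x ∷_)) p

d^_◃_ : ℕ → ℚ⟨L⟩ → ℚ⟨L⟩
d^ zero  ◃ p = p
d^ suc k ◃ p = 𝐝 ◃ (d^ k ◃ p)

_⧢₀_ : Word → Word → ℚ⟨L⟩
[]      ⧢₀ w       = ⟨ w ⟩
(𝐲 ∷ u) ⧢₀ w       = 𝐲 ◃ (u ⧢₀ w)
(𝐝 ∷ u) ⧢₀ []      = ⟨ 𝐝 ∷ u ⟩
(𝐝 ∷ u) ⧢₀ (𝐲 ∷ v) = 𝐲 ◃ ((𝐝 ∷ u) ⧢₀ v)
(𝐝 ∷ u) ⧢₀ (𝐝 ∷ v) = 𝐝 ◃ (u ⧢₀ (𝐝 ∷ v)) ⊖ (u ⧢₀ (𝐝 ∷ 𝐝 ∷ v))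

_⧢_ : Op₂ ℚ⟨L⟩
p ⧢ q = linear (λ u → linear (u ⧢₀_) q) p

------------------------------------------------------------------------
-- The quotient ℋ₀ = ℚ⟨L⟩ / 𝒮₋

data 𝒯₋ : ℚ⟨L⟩ → Set where
  gen   : ∀ w → 𝒯₋ ⟨ w ∷ʳ 𝐝 ⟩
  zero  : 𝒯₋ []
  add   : ∀ {p q} → 𝒯₋ p → 𝒯₋ q → 𝒯₋ (p ⊕ q)
  scale : ∀ c {p} → 𝒯₋ p → 𝒯₋ (c • p)
  resp  : ∀ {p q} → p ≋ q → 𝒯₋ p → 𝒯₋ q

data ℒ₋ : ℚ⟨L⟩ → Set where
  gen   : ∀ k u v → ℒ₋ (d^ k ◃ (𝐝 ◃ (u ⧢₀ v) ⊖ (𝐝 ∷ u) ⧢₀ v ⊖ u ⧢₀ (𝐝 ∷ v)))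
  zero  : ℒ₋ []
  add   : ∀ {p q} → ℒ₋ p → ℒ₋ q → ℒ₋ (p ⊕ q)
  scale : ∀ c {p} → ℒ₋ p → ℒ₋ (c • p)
  left  : ∀ r {p} → ℒ₋ p → ℒ₋ (r ⧢ p)
  right : ∀ {p} r → ℒ₋ p → ℒ₋ (p ⧢ r)
  resp  : ∀ {p q} → p ≋ q → ℒ₋ p → ℒ₋ q

𝒮₋ : ℚ⟨L⟩ → Set
𝒮₋ p = ∃₂ λ t l → 𝒯₋ t × ℒ₋ l × p ≋ t ⊕ l

ℋ₀ : RawLeftModule ℚ 0ℓ 0ℓ
ℋ₀ = record
  { Carrierᴹ = ℚ⟨L⟩ ; _≈ᴹ_ = λ p q → 𝒮₋ (p ⊖ q) ; _+ᴹ_ = _⊕_ ; _*ₗ_ = _•_ ; 0ᴹ = [] ; -ᴹ_ = ⊝_ }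

-- Words outside Y are zero in ℋ₀, so ε is the coefficient of the empty word.
ε : ℚ⟨L⟩ → ℚ
ε p = coeffᵂ p []

infix 5 _↾_
_↾_ : (w : Word) → Subset (length w) → Word
[]      ↾ []            = []
(x ∷ w) ↾ (inside  ∷ S) = x ∷ (w ↾ S)
(x ∷ w) ↾ (outside ∷ S) = w ↾ S

subsets : ∀ n → List (Subset n)
subsets zero    = [ [] ]
subsets (suc n) = map (outside ∷_) (subsets n) ++ map (inside ∷_) (subsets n)

-- For w ∈ Y, the pairs (w_S , w_S̄) whose tensors w_S ⊗ w_S̄ add up to Δ₀(w).
Δ₀ : Word → List (Word × Word)
Δ₀ w = filter (λ (u , v) → Y? u ×-dec Y? v)
              (map (λ S → (w ↾ S) , (w ↾ ∁ S)) (subsets (length w)))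

------------------------------------------------------------------------
-- Linear maps ℋ₀ → 𝒜 and the Birkhoff decomposition of φ

record LinearMap : Set where
  field
    ⟦_⟧ : ℚ⟨L⟩ → 𝒜
    isLeftModuleHomomorphism : LeftModuleMorphisms.IsLeftModuleHomomorphism ℋ₀ 𝒜-rawLeftModule ⟦_⟧

open LinearMap public

-- The value of the convolution α * β at the class of a word w ∈ Y.
infixl 7 _⋆_
_⋆_ : LinearMap → LinearMap → Word → 𝒜
(α ⋆ β) w = foldr (λ (u , v) s → ⟦ α ⟧ ⟨ u ⟩ * ⟦ β ⟧ ⟨ v ⟩ + s) 0# (Δ₀ w)

-- The classes of the words in Y span ℋ₀, so equality of convolutions need only
-- be required on such words.
_⋆_≗𝟙 : LinearMap → LinearMap → Set
α ⋆ β ≗𝟙 = ∀ {w} → Y w → (α ⋆ β) w ≈ const (ε ⟨ w ⟩)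

record Birkhoff : Set where
  field
    φ φ₊ φ₋ φ₋⁻¹ : LinearMap

    φ-𝟏 : ⟦ φ ⟧ ⟨ [] ⟩ ≈ 1#
    φ-dy : ∀ k ks → ⟦ φ ⟧ ⟨ dy (k ∷ ks) ⟩ ≈ ∂^ k (foldr (λ kᵢ g → ξ * ∂^ kᵢ g) ξ ks)

    φ₊-𝒜₊ : ∀ p → 𝒜₊ (⟦ φ₊ ⟧ p)
    φ₋-ℚ⊕𝒜₋ : ∀ p → ℚ⊕𝒜₋ (⟦ φ₋ ⟧ p)
    φ₋-𝟏 : ⟦ φ₋ ⟧ ⟨ [] ⟩ ≈ 1#
    φ₋-kerε : ∀ p → ε p ≡ 0ℚ → 𝒜₋ (⟦ φ₋ ⟧ p)

    φ₋⁻¹-𝟏 : ⟦ φ₋⁻¹ ⟧ ⟨ [] ⟩ ≈ 1#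
    φ₋⁻¹-inverseˡ : φ₋⁻¹ ⋆ φ₋ ≗𝟙
    φ₋⁻¹-inverseʳ : φ₋ ⋆ φ₋⁻¹ ≗𝟙

    φ≈φ₋⁻¹⋆φ₊ : ∀ {w} → Y w → ⟦ φ ⟧ ⟨ w ⟩ ≈ (φ₋⁻¹ ⋆ φ₊) w

-- ζ_EMS(−k₁,…,−kₙ) for the list k₁ ∷ … ∷ kₙ ∷ [].
ζ-EMS : Birkhoff → List ℕ → ℚ
ζ-EMS B ks = lim₀ (⟦ Birkhoff.φ₊ B ⟧ ⟨ dy (reverse ks) ⟩)

------------------------------------------------------------------------
-- Formal power series over a commutative ℚ-algebra K, given by its structure
-- map ι : ℚ → K

module PowerSeries (K : CommutativeRing c ℓ) (ι : ℚ → CommutativeRing.Carrier K) where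

  private module K = CommutativeRing K

  -- The sequence of coefficients.
  K[[x]] : Set c
  K[[x]] = ℕ → K.Carrier

  infix 4 _≈ˣ_
  _≈ˣ_ : K[[x]] → K[[x]] → Set ℓ
  f ≈ˣ g = ∀ n → f n K.≈ g n

  infixl 7 _*ˣ_
  _*ˣ_ : Op₂ K[[x]]
  (f *ˣ g) n = antidiagonalSum K._+_ n λ i j → f i K.* g j

  infixr 7 _·ˣ_
  _·ˣ_ : ℚ → K[[x]] → K[[x]]
  (c ·ˣ f) n = ι c K.* f n

  ∂ˣ : K[[x]] → K[[x]]
  ∂ˣ f n = ι (+ suc n / 1) K.* f (suc n)

  ∂ˣ^ : ℕ → K[[x]] → K[[x]]
  ∂ˣ^ zero    f = f
  ∂ˣ^ (suc k) f = ∂ˣ (∂ˣ^ k f)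

  -- 𝔥 B (k₁ ∷ … ∷ kₙ₋₁ ∷ []) is 𝔥_{k₁,…,kₙ₋₁}(x), and 𝔥 B [] is 𝔥(x).
  𝔥 : Birkhoff → List ℕ → K[[x]]
  𝔥 B ks k = ι ((-1ℤ ℤ.^ k) /! k ℚ.* ζ-EMS B (ks ∷ʳ k))

  -- (𝔥 ∂^{kₘ}) ⋯ (𝔥 ∂^{k₁}) (𝔥) for the list k₁ ∷ … ∷ kₘ ∷ [].
  𝔥∂ : Birkhoff → List ℕ → K[[x]]
  𝔥∂ B = foldl (λ g k → 𝔥 B [] *ˣ ∂ˣ^ k g) (𝔥 B [])

{-# OPTIONS --safe #-}

-- To a character χ of ℋ₀ and a word w attach the Taylor series ∑ₖ χ(dᵏw) tᵏ/k!.  In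
-- these terms d acts as ∂ₜ, and y as multiplication by ∑ₖ χ(dᵏy) tᵏ/k!.  Hence χ is
-- determined by the values χ(dᵏy), which can be prescribed arbitrarily and, dᵏy being
-- primitive, add up under convolution.  Now φ is the character with values ∂ᵏξ, hence the
-- convolution of the characters whose values are the polar and the regular parts of ∂ᵏξ.
-- By induction on the length of words, 𝒜₋ ∩ 𝒜₊ = 0 forces these to be φ₋⁻¹ and φ₊.  The
-- recursion for ζ_EMS compares coefficients in "Taylor series of yw = Taylor series of y
-- times Taylor series of w" for χ = φ₊, and its generating function form is
-- 𝔥_{k₁,…,kₘ} = (−1)^{kₘ} 𝔥 ∂^{kₘ} 𝔥_{k₁,…,kₘ₋₁}.

module Submission where

open import Defs hiding (_+_; _*_; -_; _≈_; 0#; 1#)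
open import Algebra.Bundles using (CommutativeRing)
import Algebra.Consequences.Setoid as Consequences
import Algebra.Construct.Pointwise as Pointwise
open import Algebra.Module.Morphism.Structures using (module LeftModuleMorphisms)
open import Algebra.Morphism.Structures using (IsRingHomomorphism)
import Algebra.Properties.CommutativeSemigroup as CommutativeSemigroupProperties
import Algebra.Properties.Group as GroupProperties
import Algebra.Properties.Ring as RingProperties
open import Data.Fin.Subset using (inside; outside; ∁)
open import Data.Integer.Base as ℤ using (ℤ; +_; -[1+_]; 0ℤ; 1ℤ; -1ℤ)
import Data.Integer.Properties as ℤ
import Data.Integer.Solver as ℤ
open import Data.List.Base
  using (List; []; _∷_; _++_; _∷ʳ_; [_]; map; foldr; filter; length; replicate; reverse; initLast; _∷ʳ′_; sum)
open import Data.List.Properties using (foldr-map; reverse-++; foldl-∷ʳ)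
open import Data.List.Reverse using (Reverse; reverseView; []; _∶_∶ʳ_)
open import Data.Nat.Base as ℕ using (ℕ; zero; suc; s≤s; _!)
open import Data.Nat.Combinatorics
  using (_C_; nCk+nC[k+1]≡[n+1]C[k+1]; k>n⇒nCk≡0; nCk≡n!/k![n-k]!; k![n∸k]!∣n!)
open import Data.Nat.DivMod using (m/n*n≡m)
open import Data.Nat.ListAction.Properties using (sum-++)
open import Data.Nat.Properties as ℕ using (_!≢0; _!*_!≢0)
open import Data.Product.Base using (_×_; _,_; ∃; ∃₂; proj₁; proj₂)
open import Data.Rational.Base as ℚ using (ℚ; 0ℚ; _/_)
import Data.Rational.Properties as ℚ
import Data.Rational.Solver as ℚ
import Data.Rational.Unnormalised.Base as ℚᵘ
import Data.Rational.Unnormalised.Properties as ℚᵘ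
open import Data.Sum.Base using (inj₁; inj₂)
open import Data.Vec.Base using ([]; _∷_)
open import Function.Base using (_∘_; flip)
open import Level using (0ℓ)
open import Relation.Binary.Bundles using (Setoid)
open import Relation.Binary.PropositionalEquality as ≡ using (_≡_; _≗_; refl)
import Relation.Binary.Reasoning.Setoid as SetoidReasoning
open import Relation.Nullary using (¬_; Dec; yes; no; contradiction)

-- That `y` acts as multiplication comes from yw = y ⧢₀ w, together with d being a derivation modulo
-- `ℒ₋`: a value at dᵏyw expands by the Leibniz rule into products of values at dⁱy and dʲw with i +
-- j = k. A letter d in front of a word shifts these data, so single values do not support a
-- recursion on letters, whereas whole Taylor series do. Characters are therefore built as functions
-- on words and compared with `φ`, `φ₋⁻¹` and `φ₊` one word at a time. The restriction to `Y` in
-- `Δ₀` would disturb such a recursion. Comparing two factorisations at a word gives only one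
-- equation for the two unknown factors. Separating them requires knowing that their errors are
-- polar and regular respectively, which rests on `𝒜₋` and `𝒜₊` being closed under sums and
-- products.

toℚᵘ-/ : ∀ i n .{{_ : ℕ.NonZero n}} → ℚ.toℚᵘ (i / n) ℚᵘ.≃ i ℚᵘ./ n
toℚᵘ-/ i (suc n) = ℚ.toℚᵘ-fromℚᵘ (ℚᵘ.mkℚᵘ i n)

/-*-/ : ∀ i j m n .{{_ : ℕ.NonZero m}} .{{_ : ℕ.NonZero n}} .{{_ : ℕ.NonZero (m ℕ.* n)}} →
        (i / m) ℚ.* (j / n) ≡ (i ℤ.* j) / (m ℕ.* n)
/-*-/ i j m@(suc m-1) n@(suc n-1) = ℚ.toℚᵘ-injective (begin
  ℚ.toℚᵘ ((i / m) ℚ.* (j / n))           ≈⟨ ℚ.toℚᵘ-homo-* (i / m) (j / n) ⟩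
  ℚ.toℚᵘ (i / m) ℚᵘ.* ℚ.toℚᵘ (j / n)     ≈⟨ ℚᵘ.*-cong (toℚᵘ-/ i m) (toℚᵘ-/ j n) ⟩
  (i ℚᵘ./ m) ℚᵘ.* (j ℚᵘ./ n)             ≈⟨ ℚᵘ.≃-refl ⟩
  (i ℤ.* j) ℚᵘ./ (m ℕ.* n)               ≈⟨ toℚᵘ-/ (i ℤ.* j) (m ℕ.* n) ⟨
  ℚ.toℚᵘ ((i ℤ.* j) / (m ℕ.* n))         ∎)
  where open SetoidReasoning ℚᵘ.≃-setoid

/-≡ : ∀ i j m n .{{_ : ℕ.NonZero m}} .{{_ : ℕ.NonZero n}} → i ℤ.* + n ≡ j ℤ.* + m → i / m ≡ j / n
/-≡ i j (suc m) (suc n) eq = ℚ.fromℚᵘ-cong {ℚᵘ.mkℚᵘ i m} {ℚᵘ.mkℚᵘ j n} (ℚᵘ.*≡* eq)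

/1-homo-+ : ∀ i j → (i ℤ.+ j) / 1 ≡ i / 1 ℚ.+ j / 1
/1-homo-+ i j = ℚ.toℚᵘ-injective (begin
  ℚ.toℚᵘ ((i ℤ.+ j) / 1)                    ≈⟨ toℚᵘ-/ (i ℤ.+ j) 1 ⟩
  ℚᵘ.mkℚᵘ (i ℤ.+ j) 0                       ≈⟨ ℚᵘ.*≡* cross ⟩
  ℚᵘ.mkℚᵘ i 0 ℚᵘ.+ ℚᵘ.mkℚᵘ j 0              ≈⟨ ℚᵘ.+-cong (toℚᵘ-/ i 1) (toℚᵘ-/ j 1) ⟨
  ℚ.toℚᵘ (i / 1) ℚᵘ.+ ℚ.toℚᵘ (j / 1)        ≈⟨ ℚ.toℚᵘ-homo-+ (i / 1) (j / 1) ⟨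
  ℚ.toℚᵘ (i / 1 ℚ.+ j / 1)                  ∎)
  where
  open SetoidReasoning ℚᵘ.≃-setoid
  open ℤ.+-*-Solver
  cross : (i ℤ.+ j) ℤ.* 1ℤ ≡ (i ℤ.* 1ℤ ℤ.+ j ℤ.* 1ℤ) ℤ.* 1ℤ
  cross = solve 2 (λ i j → (i :+ j) :* con 1ℤ := (i :* con 1ℤ :+ j :* con 1ℤ) :* con 1ℤ) refl i j

/1-homo-* : ∀ i j → (i ℤ.* j) / 1 ≡ (i / 1) ℚ.* (j / 1)
/1-homo-* i j = ≡.sym (/-*-/ i j 1 1)

-- Power series over a commutative ring, ordinary and exponential

module CauchyProduct {c ℓ} (R : CommutativeRing c ℓ) where

  open CommutativeRing R renaming (refl to ≈-refl)
  open CommutativeSemigroupProperties +-commutativeSemigroup using (interchange)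
  open SetoidReasoning setoid

  ∑ : ℕ → (ℕ → ℕ → Carrier) → Carrier
  ∑ = antidiagonalSum _+_

  -- The equation `i + j ≡ n` is handed to the summands because later identities split a quantity
  -- depending on `n`, such as `n - (N + M)` or `(-1)ⁿ/n!`, into parts depending on `i` and `j`.
  ∑-congᵢ : ∀ n {f g} → (∀ i j → i ℕ.+ j ≡ n → f i j ≈ g i j) → ∑ n f ≈ ∑ n g
  ∑-congᵢ zero    f≈g = f≈g 0 0 refl
  ∑-congᵢ (suc n) f≈g = +-cong (f≈g 0 (suc n) refl) (∑-congᵢ n λ i j eq → f≈g (suc i) j (≡.cong suc eq))

  ∑-cong : ∀ n {f g} → (∀ i j → f i j ≈ g i j) → ∑ n f ≈ ∑ n g
  ∑-cong n f≈g = ∑-congᵢ n λ i j _ → f≈g i j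

  ∑-zero : ∀ n → ∑ n (λ _ _ → 0#) ≈ 0#
  ∑-zero zero    = ≈-refl
  ∑-zero (suc n) = trans (+-identityˡ _) (∑-zero n)

  ∑-+ : ∀ n f g → ∑ n (λ i j → f i j + g i j) ≈ ∑ n f + ∑ n g
  ∑-+ zero    f g = ≈-refl
  ∑-+ (suc n) f g = trans (+-congˡ (∑-+ n _ _)) (interchange _ _ _ _)

  *-distribˡ-∑ : ∀ n a f → a * ∑ n f ≈ ∑ n (λ i j → a * f i j)
  *-distribˡ-∑ zero    a f = ≈-refl
  *-distribˡ-∑ (suc n) a f = trans (distribˡ _ _ _) (+-congˡ (*-distribˡ-∑ n a _))

  -- `antidiagonalSum` unfolds from `i = 0`; reversing the summation and Pascal's rule need the
  -- other end, `j = 0`.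
  ∑-last : ∀ n f → ∑ (suc n) f ≈ ∑ n (λ i j → f i (suc j)) + f (suc n) 0
  ∑-last zero    f = ≈-refl
  ∑-last (suc n) f = trans (+-congˡ (∑-last n λ i j → f (suc i) j)) (sym (+-assoc _ _ _))

  ∑-flip : ∀ n f → ∑ n f ≈ ∑ n (flip f)
  ∑-flip zero    f = ≈-refl
  ∑-flip (suc n) f = begin
    f 0 (suc n) + ∑ n (λ i j → f (suc i) j)  ≈⟨ +-congˡ (∑-flip n _) ⟩
    f 0 (suc n) + ∑ n (λ i j → f (suc j) i)  ≈⟨ +-comm _ _ ⟩
    ∑ n (λ i j → f (suc j) i) + f 0 (suc n)  ≈⟨ ∑-last n (flip f) ⟨
    ∑ (suc n) (flip f)                       ∎

  infix 4 _≋ₛ_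
  _≋ₛ_ : (f g : ℕ → Carrier) → Set ℓ
  f ≋ₛ g = ∀ n → f n ≈ g n

  infixl 7 _⊛_
  _⊛_ : (f g : ℕ → Carrier) → ℕ → Carrier
  (f ⊛ g) n = ∑ n λ i j → f i * g j

  ⊛-cong : ∀ {f f′ g g′} → f ≋ₛ f′ → g ≋ₛ g′ → f ⊛ g ≋ₛ f′ ⊛ g′
  ⊛-cong f≈f′ g≈g′ n = ∑-cong n λ i j → *-cong (f≈f′ i) (g≈g′ j)

  ⊛-comm : ∀ f g → f ⊛ g ≋ₛ g ⊛ f
  ⊛-comm f g n = trans (∑-flip n _) (∑-cong n λ i j → *-comm (f j) (g i))

  ⊛-distribˡ : ∀ f g h → f ⊛ (λ n → g n + h n) ≋ₛ λ n → (f ⊛ g) n + (f ⊛ h) n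
  ⊛-distribˡ f g h n = trans (∑-cong n λ i j → distribˡ _ _ _) (∑-+ n _ _)

  ⊛-distribʳ : ∀ f g h → (λ n → g n + h n) ⊛ f ≋ₛ λ n → (g ⊛ f) n + (h ⊛ f) n
  ⊛-distribʳ f g h n = trans (∑-cong n λ i j → distribʳ _ _ _) (∑-+ n _ _)

  ⊛-scale : ∀ a f g → (λ n → a * f n) ⊛ g ≋ₛ λ n → a * (f ⊛ g) n
  ⊛-scale a f g n = trans (∑-cong n λ i j → *-assoc _ _ _) (sym (*-distribˡ-∑ n a _))

  -- The induction splits off the constant term of `f`: by definition, the shift of `f ⊛ g` is `f 0`
  -- times the shift of `g`, plus the product of the shift of `f` with `g`.
  ⊛-assoc : ∀ f g h → (f ⊛ g) ⊛ h ≋ₛ f ⊛ (g ⊛ h)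
  ⊛-assoc f g h zero    = *-assoc _ _ _
  ⊛-assoc f g h (suc n) = begin
    f 0 * g 0 * h (suc n) + ((λ m → f 0 * g (suc m) + (f ∘ suc ⊛ g) m) ⊛ h) n
      ≈⟨ +-cong (*-assoc _ _ _) (⊛-distribʳ h _ _ n) ⟩
    f 0 * (g 0 * h (suc n)) + (((λ m → f 0 * g (suc m)) ⊛ h) n + (f ∘ suc ⊛ g ⊛ h) n)
      ≈⟨ +-congˡ (+-cong (⊛-scale (f 0) (g ∘ suc) h n) (⊛-assoc (f ∘ suc) g h n)) ⟩
    f 0 * (g 0 * h (suc n)) + (f 0 * (g ∘ suc ⊛ h) n + (f ∘ suc ⊛ (g ⊛ h)) n)
      ≈⟨ +-assoc _ _ _ ⟨
    f 0 * (g 0 * h (suc n)) + f 0 * (g ∘ suc ⊛ h) n + (f ∘ suc ⊛ (g ⊛ h)) n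
      ≈⟨ +-congʳ (distribˡ _ _ _) ⟨
    f 0 * (g ⊛ h) (suc n) + (f ∘ suc ⊛ (g ⊛ h)) n
      ∎

  ⊛-identityˡ : ∀ {e} → e 0 ≈ 1# → (∀ n → e (suc n) ≈ 0#) → ∀ f → e ⊛ f ≋ₛ f
  ⊛-identityˡ e₀ eₙ f zero    = trans (*-congʳ e₀) (*-identityˡ _)
  ⊛-identityˡ {e} e₀ eₙ f (suc n) = begin
    e 0 * f (suc n) + ∑ n (λ i j → e (suc i) * f j)
      ≈⟨ +-cong (trans (*-congʳ e₀) (*-identityˡ _))
                (trans (∑-cong n λ i j → trans (*-congʳ (eₙ i)) (zeroˡ (f j))) (∑-zero n)) ⟩
    f (suc n) + 0#  ≈⟨ +-identityʳ _ ⟩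
    f (suc n)       ∎

-- The sequence f stands for the series ∑ₙ f(n) tⁿ/n!; then differentiation is the
-- shift f ∘ suc, and the product is determined by its value at 0 and the Leibniz rule.
module Hurwitz {c ℓ} (R : CommutativeRing c ℓ) where

  open CommutativeRing R renaming (refl to ≈-refl)
  open CommutativeSemigroupProperties +-commutativeSemigroup using (interchange)
  open SetoidReasoning setoid

  infix 4 _≈ᴴ_
  _≈ᴴ_ : (f g : ℕ → Carrier) → Set ℓ
  f ≈ᴴ g = ∀ n → f n ≈ g n

  infixl 6 _+ᴴ_
  infixl 7 _*ᴴ_
  _+ᴴ_ _*ᴴ_ : (f g : ℕ → Carrier) → ℕ → Carrier
  (f +ᴴ g) n = f n + g n
  (f *ᴴ g) zero    = f 0 * g 0
  (f *ᴴ g) (suc n) = (f ∘ suc *ᴴ g) n + (f *ᴴ g ∘ suc) n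

  0ᴴ 1ᴴ : ℕ → Carrier
  0ᴴ _ = 0#
  1ᴴ zero    = 1#
  1ᴴ (suc _) = 0#

  *ᴴ-cong : ∀ {f f′ g g′} → f ≈ᴴ f′ → g ≈ᴴ g′ → f *ᴴ g ≈ᴴ f′ *ᴴ g′
  *ᴴ-cong f≈f′ g≈g′ zero    = *-cong (f≈f′ 0) (g≈g′ 0)
  *ᴴ-cong f≈f′ g≈g′ (suc n) = +-cong (*ᴴ-cong (f≈f′ ∘ suc) g≈g′ n) (*ᴴ-cong f≈f′ (g≈g′ ∘ suc) n)

  *ᴴ-comm : ∀ f g → f *ᴴ g ≈ᴴ g *ᴴ f
  *ᴴ-comm f g zero    = *-comm _ _
  *ᴴ-comm f g (suc n) = trans (+-cong (*ᴴ-comm (f ∘ suc) g n) (*ᴴ-comm f (g ∘ suc) n)) (+-comm _ _)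

  *ᴴ-distribʳ : ∀ f g h → (g +ᴴ h) *ᴴ f ≈ᴴ g *ᴴ f +ᴴ h *ᴴ f
  *ᴴ-distribʳ f g h zero    = distribʳ _ _ _
  *ᴴ-distribʳ f g h (suc n) =
    trans (+-cong (*ᴴ-distribʳ f (g ∘ suc) (h ∘ suc) n) (*ᴴ-distribʳ (f ∘ suc) g h n)) (interchange _ _ _ _)

  *ᴴ-distribˡ : ∀ f g h → f *ᴴ (g +ᴴ h) ≈ᴴ f *ᴴ g +ᴴ f *ᴴ h
  *ᴴ-distribˡ f g h n = trans (*ᴴ-comm f _ n) (trans (*ᴴ-distribʳ f g h n) (+-cong (*ᴴ-comm g f n) (*ᴴ-comm h f n)))

  -- Differentiating either bracketing gives the same three products with one factor differentiated,
  -- so the claim at `suc n` reduces to three claims at `n`.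
  *ᴴ-assoc : ∀ f g h → (f *ᴴ g) *ᴴ h ≈ᴴ f *ᴴ (g *ᴴ h)
  *ᴴ-assoc f g h zero    = *-assoc _ _ _
  *ᴴ-assoc f g h (suc n) = begin
    ((f ∘ suc *ᴴ g +ᴴ f *ᴴ g ∘ suc) *ᴴ h) n + (f *ᴴ g *ᴴ h ∘ suc) n
      ≈⟨ +-congʳ (*ᴴ-distribʳ h _ _ n) ⟩
    ((f ∘ suc *ᴴ g) *ᴴ h) n + ((f *ᴴ g ∘ suc) *ᴴ h) n + (f *ᴴ g *ᴴ h ∘ suc) n
      ≈⟨ +-assoc _ _ _ ⟩
    ((f ∘ suc *ᴴ g) *ᴴ h) n + (((f *ᴴ g ∘ suc) *ᴴ h) n + (f *ᴴ g *ᴴ h ∘ suc) n)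
      ≈⟨ +-cong (*ᴴ-assoc (f ∘ suc) g h n)
                (+-cong (*ᴴ-assoc f (g ∘ suc) h n) (*ᴴ-assoc f g (h ∘ suc) n)) ⟩
    (f ∘ suc *ᴴ (g *ᴴ h)) n + ((f *ᴴ (g ∘ suc *ᴴ h)) n + (f *ᴴ (g *ᴴ h ∘ suc)) n)
      ≈⟨ +-congˡ (*ᴴ-distribˡ f _ _ n) ⟨
    (f ∘ suc *ᴴ (g *ᴴ h)) n + (f *ᴴ (g ∘ suc *ᴴ h +ᴴ g *ᴴ h ∘ suc)) n
      ∎

  *ᴴ-zeroˡ : ∀ f → 0ᴴ *ᴴ f ≈ᴴ 0ᴴ
  *ᴴ-zeroˡ f zero    = zeroˡ _
  *ᴴ-zeroˡ f (suc n) = trans (+-cong (*ᴴ-zeroˡ f n) (*ᴴ-zeroˡ (f ∘ suc) n)) (+-identityˡ _)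

  *ᴴ-identityˡ : ∀ f → 1ᴴ *ᴴ f ≈ᴴ f
  *ᴴ-identityˡ f zero    = *-identityˡ _
  *ᴴ-identityˡ f (suc n) = trans (+-cong (*ᴴ-zeroˡ f n) (*ᴴ-identityˡ (f ∘ suc) n)) (+-identityˡ _)

  -- The ring structure allows `SplittingSum` to be instantiated with whole Taylor series as
  -- summands.
  commutativeRing : CommutativeRing c ℓ
  commutativeRing = record
    { Carrier = ℕ → Carrier ; _≈_ = _≈ᴴ_ ; _+_ = _+ᴴ_ ; _*_ = _*ᴴ_ ; -_ = -_ ∘_ ; 0# = 0ᴴ ; 1# = 1ᴴ
    ; isCommutativeRing = record
      { isRing = record
        { +-isAbelianGroup = Pointwise.isAbelianGroup ℕ +-isAbelianGroup
        ; *-cong = *ᴴ-cong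
        ; *-assoc = *ᴴ-assoc
        ; *-identity = *ᴴ-identityˡ , λ f n → trans (*ᴴ-comm f 1ᴴ n) (*ᴴ-identityˡ f n)
        ; distrib = *ᴴ-distribˡ , *ᴴ-distribʳ
        }
      ; *-comm = *ᴴ-comm
      }
    }

-- Splittings of words and characters

module SplittingSum {c ℓ} (R : CommutativeRing c ℓ) where

  open CommutativeRing R renaming (refl to ≈-refl)
  open CommutativeSemigroupProperties +-commutativeSemigroup using (interchange)
  open SetoidReasoning setoid

  -- ∑[u⧢v∋ w ] F is the sum of F(w_S, w_S̄) over all sets S of positions in w.
  ∑[u⧢v∋_] : Word → (Word → Word → Carrier) → Carrier
  ∑[u⧢v∋ []    ] F = F [] []
  ∑[u⧢v∋ x ∷ w ] F = ∑[u⧢v∋ w ] (λ u v → F u (x ∷ v)) + ∑[u⧢v∋ w ] (λ u v → F (x ∷ u) v)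

  ∑-cong : ∀ w {F G} → (∀ u v → F u v ≈ G u v) → ∑[u⧢v∋ w ] F ≈ ∑[u⧢v∋ w ] G
  ∑-cong []      F≈G = F≈G [] []
  ∑-cong (x ∷ w) F≈G = +-cong (∑-cong w λ u v → F≈G u (x ∷ v)) (∑-cong w λ u v → F≈G (x ∷ u) v)

  ∑-+ : ∀ w F G → ∑[u⧢v∋ w ] (λ u v → F u v + G u v) ≈ ∑[u⧢v∋ w ] F + ∑[u⧢v∋ w ] G
  ∑-+ []      F G = ≈-refl
  ∑-+ (x ∷ w) F G = trans (+-cong (∑-+ w _ _) (∑-+ w _ _)) (interchange _ _ _ _)

  *-distribˡ-∑ : ∀ a w F → a * ∑[u⧢v∋ w ] F ≈ ∑[u⧢v∋ w ] (λ u v → a * F u v)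
  *-distribˡ-∑ a []      F = ≈-refl
  *-distribˡ-∑ a (x ∷ w) F = trans (distribˡ _ _ _) (+-cong (*-distribˡ-∑ a w _) (*-distribˡ-∑ a w _))

  ∑-flip : ∀ w F → ∑[u⧢v∋ w ] F ≈ ∑[u⧢v∋ w ] (flip F)
  ∑-flip []      F = ≈-refl
  ∑-flip (x ∷ w) F = trans (+-cong (∑-flip w _) (∑-flip w _)) (+-comm _ _)

  module _ {m} {M : Carrier → Set m} (M-resp : ∀ {a b} → a ≈ b → M a → M b)
           (M-+ : ∀ {a b} → M a → M b → M (a + b)) where

    ∑-closed : ∀ w {F} → (∀ u v → length u ℕ.+ length v ≡ length w → M (F u v)) → M (∑[u⧢v∋ w ] F)
    ∑-closed []      F∈M = F∈M [] [] refl
    ∑-closed (x ∷ w) F∈M = M-+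
      (∑-closed w λ u v eq → F∈M u (x ∷ v) (≡.trans (ℕ.+-suc _ _) (≡.cong suc eq)))
      (∑-closed w λ u v eq → F∈M (x ∷ u) v (≡.cong suc eq))

    -- Among all splittings, only `(w , [])` has a first component as long as `w`. For `M` the
    -- predicate `_≈ 0#` this evaluates a sum, for `M = 𝒜₋` it isolates the value at `w` in an
    -- inverse relation.
    ∑-leading : M 0# → ∀ w {F} →
                (∀ u v → length u ℕ.< length w → length u ℕ.+ length v ≡ length w → M (F u v)) →
                M (∑[u⧢v∋ w ] F - F w [])
    ∑-leading M-0 []      F∈M = M-resp (sym (-‿inverseʳ _)) M-0
    ∑-leading M-0 (x ∷ w) F∈M = M-resp (sym (+-assoc _ _ _)) (M-+
      (∑-closed w λ u v eq → F∈M u (x ∷ v)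
        (s≤s (ℕ.≤-trans (ℕ.m≤m+n _ _) (ℕ.≤-reflexive eq))) (≡.trans (ℕ.+-suc _ _) (≡.cong suc eq)))
      (∑-leading M-0 w λ u v lt eq → F∈M (x ∷ u) v (s≤s lt) (≡.cong suc eq)))

  -- Telescoping, `a b - a′ b′ = (a - a′) b + a′ (b - b′)`. The first part survives only at the
  -- splitting `(w , [])`, the second only at `([] , w)`, so each sum collapses to one error term.
  ∑-*-determines : ∀ w {a a′ b b′ : Word → Carrier} →
    (∀ u → length u ℕ.< length w → a u ≈ a′ u) → (∀ v → length v ℕ.< length w → b v ≈ b′ v) →
    a′ [] ≈ 1# → b [] ≈ 1# →
    ∑[u⧢v∋ w ] (λ u v → a u * b v) ≈ ∑[u⧢v∋ w ] (λ u v → a′ u * b′ v) →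
    (a w - a′ w) + (b w - b′ w) ≈ 0#
  ∑-*-determines w {a} {a′} {b} {b′} a≈a′ b≈b′ a′[] b[] eq = begin
    (a w - a′ w) + (b w - b′ w)
      ≈⟨ +-cong (trans (*-congˡ b[]) (*-identityʳ _)) (trans (*-congʳ a′[]) (*-identityˡ _)) ⟨
    (a w - a′ w) * b [] + a′ [] * (b w - b′ w)
      ≈⟨ +-cong
           (leading (λ u v u<w → trans (*-congʳ (x≈y⇒x∙y⁻¹≈ε (a≈a′ u u<w))) (zeroˡ (b v))))
           (trans (∑-flip w _)
                  (leading (λ v u v<w → trans (*-congˡ (x≈y⇒x∙y⁻¹≈ε (b≈b′ v v<w))) (zeroʳ (a′ u))))) ⟨
    ∑[u⧢v∋ w ] (λ u v → (a u - a′ u) * b v) + ∑[u⧢v∋ w ] (λ u v → a′ u * (b v - b′ v))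
      ≈⟨ ∑-+ w _ _ ⟨
    ∑[u⧢v∋ w ] difference
      ≈⟨ +-identityˡ-unique _ (∑[u⧢v∋ w ] λ u v → a′ u * b′ v) (begin
           ∑[u⧢v∋ w ] difference + ∑[u⧢v∋ w ] (λ u v → a′ u * b′ v)   ≈⟨ ∑-+ w _ _ ⟨
           ∑[u⧢v∋ w ] (λ u v → difference u v + a′ u * b′ v)          ≈⟨ ∑-cong w telescope ⟩
           ∑[u⧢v∋ w ] (λ u v → a u * b v)                             ≈⟨ eq ⟩
           ∑[u⧢v∋ w ] (λ u v → a′ u * b′ v)                           ∎) ⟩
    0#  ∎
    where
    open RingProperties ring using (+-identityˡ-unique)
    open GroupProperties +-group using (x≈y⇒x∙y⁻¹≈ε; x∙y⁻¹≈ε⇒x≈y; //-rightDividesˡ)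
    difference = λ u v → (a u - a′ u) * b v + a′ u * (b v - b′ v)
    leading : ∀ {F} → (∀ u v → length u ℕ.< length w → F u v ≈ 0#) → ∑[u⧢v∋ w ] F ≈ F w []
    leading {F} F≈0 = x∙y⁻¹≈ε⇒x≈y _ _ (∑-leading {M = _≈ 0#} (λ a≈b a≈0 → trans (sym a≈b) a≈0)
      (λ a≈0 b≈0 → trans (+-cong a≈0 b≈0) (+-identityˡ 0#)) ≈-refl w λ u v u<w _ → F≈0 u v u<w)
    telescope : ∀ u v → difference u v + a′ u * b′ v ≈ a u * b v
    telescope u v = begin
      (a u - a′ u) * b v + a′ u * (b v - b′ v) + a′ u * b′ v
        ≈⟨ +-assoc _ _ _ ⟩
      (a u - a′ u) * b v + (a′ u * (b v - b′ v) + a′ u * b′ v)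
        ≈⟨ +-congˡ (distribˡ _ _ _) ⟨
      (a u - a′ u) * b v + a′ u * (b v - b′ v + b′ v)
        ≈⟨ +-congˡ (*-congˡ (//-rightDividesˡ (b′ v) (b v))) ⟩
      (a u - a′ u) * b v + a′ u * b v
        ≈⟨ distribʳ _ _ _ ⟨
      (a u - a′ u + a′ u) * b v
        ≈⟨ *-congʳ (//-rightDividesˡ (a′ u) (a u)) ⟩
      a u * b v
        ∎

  private
    ∑ₗ : ∀ {a} {A : Set a} → (A → Carrier) → List A → Carrier
    ∑ₗ f = foldr (λ a s → f a + s) 0#

    ∑ₗ-++ : ∀ {a} {A : Set a} (f : A → Carrier) xs ys → ∑ₗ f (xs ++ ys) ≈ ∑ₗ f xs + ∑ₗ f ys
    ∑ₗ-++ f []       ys = sym (+-identityˡ _)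
    ∑ₗ-++ f (x ∷ xs) ys = trans (+-congˡ (∑ₗ-++ f xs ys)) (sym (+-assoc _ _ _))

    ∑ₗ-filter : ∀ {a p} {A : Set a} {P : A → Set p} (P? : ∀ a → Dec (P a)) {f : A → Carrier} →
                (∀ a → ¬ P a → f a ≈ 0#) → ∀ xs → ∑ₗ f (filter P? xs) ≈ ∑ₗ f xs
    ∑ₗ-filter P? f≈0 []       = ≈-refl
    ∑ₗ-filter P? f≈0 (x ∷ xs) with P? x
    ... | yes _  = +-congˡ (∑ₗ-filter P? f≈0 xs)
    ... | no  ¬p = trans (∑ₗ-filter P? f≈0 xs) (sym (trans (+-congʳ (f≈0 x ¬p)) (+-identityˡ _)))

    ∑ₗ-subsets : ∀ w F → ∑ₗ (λ S → F (w ↾ S) (w ↾ ∁ S)) (subsets (length w)) ≈ ∑[u⧢v∋ w ] F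
    ∑ₗ-subsets []      F = +-identityʳ _
    ∑ₗ-subsets (x ∷ w) F = begin
      ∑ₗ G (map (outside ∷_) Ss ++ map (inside ∷_) Ss)
        ≈⟨ ∑ₗ-++ G (map (outside ∷_) Ss) _ ⟩
      ∑ₗ G (map (outside ∷_) Ss) + ∑ₗ G (map (inside ∷_) Ss)
        ≡⟨ ≡.cong₂ _+_ (foldr-map _ _ 0# Ss) (foldr-map _ _ 0# Ss) ⟩
      ∑ₗ (G ∘ (outside ∷_)) Ss + ∑ₗ (G ∘ (inside ∷_)) Ss
        ≈⟨ +-cong (∑ₗ-subsets w _) (∑ₗ-subsets w _) ⟩
      ∑[u⧢v∋ x ∷ w ] F ∎
      where
      Ss = subsets (length w)
      G = λ S → F ((x ∷ w) ↾ S) ((x ∷ w) ↾ ∁ S)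

  -- Words outside Y contribute nothing, so the restriction to Y in Δ₀ may be dropped.
  ∑-Δ₀ : ∀ w {F} → (∀ u v → ¬ (Y u × Y v) → F u v ≈ 0#) →
         foldr (λ (u , v) s → F u v + s) 0# (Δ₀ w) ≈ ∑[u⧢v∋ w ] F
  ∑-Δ₀ w {F} F≈0 = begin
    ∑ₗ (λ (u , v) → F u v) (Δ₀ w)
      ≈⟨ ∑ₗ-filter _ (λ (u , v) → F≈0 u v) (map _ (subsets (length w))) ⟩
    ∑ₗ (λ (u , v) → F u v) (map _ (subsets (length w)))
      ≡⟨ foldr-map _ _ 0# (subsets (length w)) ⟩
    ∑ₗ (λ S → F (w ↾ S) (w ↾ ∁ S)) (subsets (length w))
      ≈⟨ ∑ₗ-subsets w F ⟩
    ∑[u⧢v∋ w ] F ∎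

-- Taylor p w is the Taylor series ∑ₖ χ(dᵏw) tᵏ/k! of the character χ of ℋ₀ with χ(dᵏy) = p(k).
module Character {c ℓ} (R : CommutativeRing c ℓ) where

  open CommutativeRing R renaming (refl to ≈-refl)
  open Hurwitz R
  open SplittingSum R using (∑[u⧢v∋_])
  private
    module ℍ where
      open CommutativeRing commutativeRing public
      open SplittingSum commutativeRing public

  Taylor : (ℕ → Carrier) → Word → ℕ → Carrier
  Taylor p []      = 1ᴴ
  Taylor p (𝐝 ∷ w) = Taylor p w ∘ suc
  Taylor p (𝐲 ∷ w) = p *ᴴ Taylor p w

  character : (ℕ → Carrier) → Word → Carrier
  character p w = Taylor p w 0

  Taylor-cong : ∀ {p q} → p ≈ᴴ q → ∀ w → Taylor p w ≈ᴴ Taylor q w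
  Taylor-cong p≈q []      = ℍ.refl
  Taylor-cong p≈q (𝐝 ∷ w) = Taylor-cong p≈q w ∘ suc
  Taylor-cong p≈q (𝐲 ∷ w) = *ᴴ-cong p≈q (Taylor-cong p≈q w)

  Taylor-d^ : ∀ p k w j → Taylor p (replicate k 𝐝 ++ w) j ≡ Taylor p w (k ℕ.+ j)
  Taylor-d^ p zero    w j = refl
  Taylor-d^ p (suc k) w j = ≡.trans (Taylor-d^ p k w (suc j)) (≡.cong (Taylor p w) (ℕ.+-suc k j))

  -- The last letter differentiates the constant series 1, and all other letters preserve 0. This
  -- mirrors the generators of `𝒯₋`.
  Taylor-wd : ∀ p w → Taylor p (w ∷ʳ 𝐝) ≈ᴴ 0ᴴ
  Taylor-wd p []      = ℍ.refl
  Taylor-wd p (𝐝 ∷ w) = Taylor-wd p w ∘ suc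
  Taylor-wd p (𝐲 ∷ w) = ℍ.trans (*ᴴ-cong (ℍ.refl {p}) (Taylor-wd p w)) (ℍ.zeroʳ p)

  -- Each letter is primitive: in a product of two series, d falls on either factor by the Leibniz
  -- rule, and y multiplies by `p +ᴴ q`, whose two summands go to one factor each. The claim
  -- concerns series since the case of d uses the induction hypothesis at the next coefficient.
  Taylor-+ : ∀ p q w → Taylor (p +ᴴ q) w ≈ᴴ ℍ.∑[u⧢v∋ w ] (λ u v → Taylor p u *ᴴ Taylor q v)
  Taylor-+ p q []      = ℍ.sym (*ᴴ-identityˡ 1ᴴ)
  Taylor-+ p q (𝐝 ∷ w) = begin
    Taylor (p +ᴴ q) w ∘ suc                     ≈⟨ Taylor-+ p q w ∘ suc ⟩
    ℍ.∑[u⧢v∋ w ] F ∘ suc                        ≈⟨ ∑-suc w F ⟩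
    -- `F u v ∘ suc` is `F (𝐝 ∷ u) v +ᴴ F u (𝐝 ∷ v)` by the defining clause of `_*ᴴ_`.
    ℍ.∑[u⧢v∋ w ] (λ u v → F u v ∘ suc)          ≈⟨ ℍ.∑-+ w _ _ ⟩
    ℍ.∑[u⧢v∋ w ] (λ u v → F (𝐝 ∷ u) v) +ᴴ ℍ.∑[u⧢v∋ w ] (λ u v → F u (𝐝 ∷ v))
                                                ≈⟨ ℍ.+-comm _ (ℍ.∑[u⧢v∋ w ] λ u v → F u (𝐝 ∷ v)) ⟩
    ℍ.∑[u⧢v∋ 𝐝 ∷ w ] F ∎
    where
    open SetoidReasoning ℍ.setoid
    F = λ u v → Taylor p u *ᴴ Taylor q v
    ∑-suc : ∀ w F → ℍ.∑[u⧢v∋ w ] F ∘ suc ≈ᴴ ℍ.∑[u⧢v∋ w ] (λ u v → F u v ∘ suc)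
    ∑-suc []      F   = ℍ.refl
    ∑-suc (x ∷ w) F n = +-cong (∑-suc w _ n) (∑-suc w _ n)
  Taylor-+ p q (𝐲 ∷ w) = begin
    (p +ᴴ q) *ᴴ Taylor (p +ᴴ q) w
      ≈⟨ ℍ.*-congˡ {p +ᴴ q} (Taylor-+ p q w) ⟩
    (p +ᴴ q) *ᴴ ∑F
      ≈⟨ *ᴴ-distribʳ ∑F p q ⟩
    p *ᴴ ∑F +ᴴ q *ᴴ ∑F
      ≈⟨ ℍ.+-comm (p *ᴴ ∑F) (q *ᴴ ∑F) ⟩
    q *ᴴ ∑F +ᴴ p *ᴴ ∑F
      ≈⟨ ℍ.+-cong (ℍ.*-distribˡ-∑ q w F) (ℍ.*-distribˡ-∑ p w F) ⟩
    ℍ.∑[u⧢v∋ w ] (λ u v → q *ᴴ F u v) +ᴴ ℍ.∑[u⧢v∋ w ] (λ u v → p *ᴴ F u v)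
      ≈⟨ ℍ.+-cong (ℍ.∑-cong w λ u v → x∙yz≈y∙xz q (Taylor p u) (Taylor q v))
                  (ℍ.∑-cong w λ u v → ℍ.sym (*ᴴ-assoc p (Taylor p u) (Taylor q v))) ⟩
    ℍ.∑[u⧢v∋ 𝐲 ∷ w ] F ∎
    where
    open SetoidReasoning ℍ.setoid
    open CommutativeSemigroupProperties ℍ.*-commutativeSemigroup using (x∙yz≈y∙xz)
    F = λ u v → Taylor p u *ᴴ Taylor q v
    ∑F = ℍ.∑[u⧢v∋ w ] F

  character-+ : ∀ p q w → character (p +ᴴ q) w ≈ ∑[u⧢v∋ w ] (λ u v → character p u * character q v)
  character-+ p q w = trans (Taylor-+ p q w 0) (∑-at-0 w _)
    where
    ∑-at-0 : ∀ w F → ℍ.∑[u⧢v∋ w ] F 0 ≈ ∑[u⧢v∋ w ] (λ u v → F u v 0)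
    ∑-at-0 []      F = ≈-refl
    ∑-at-0 (x ∷ w) F = +-cong (∑-at-0 w _) (∑-at-0 w _)

  module _ {m} {M : Carrier → Set m} (M-resp : ∀ {a b} → a ≈ b → M a → M b) (M-0 : M 0#)
           (M-+ : ∀ {a b} → M a → M b → M (a + b)) (M-* : ∀ {a b} → M a → M b → M (a * b)) where

    *ᴴ-closed : ∀ {f g} → (∀ k → M (f k)) → (∀ k → M (g k)) → ∀ k → M ((f *ᴴ g) k)
    *ᴴ-closed f∈M g∈M zero    = M-* (f∈M 0) (g∈M 0)
    *ᴴ-closed f∈M g∈M (suc k) = M-+ (*ᴴ-closed (f∈M ∘ suc) g∈M k) (*ᴴ-closed f∈M (g∈M ∘ suc) k)

    -- The word is nonempty because the empty word has Taylor series 1, while `M` need not contain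
    -- `1#`: this is so for `𝒜₋`. For the same reason the one-letter word y is treated apart.
    Taylor-closed : ∀ {p} → (∀ k → M (p k)) → ∀ x w k → M (Taylor p (x ∷ w) k)
    Taylor-closed p∈M 𝐝 []      k = M-0
    Taylor-closed p∈M 𝐝 (x ∷ w) k = Taylor-closed p∈M x w (suc k)
    Taylor-closed {p} p∈M 𝐲 [] k = M-resp (sym (ℍ.*-identityʳ p k)) (p∈M k)
    Taylor-closed p∈M 𝐲 (x ∷ w)   = *ᴴ-closed p∈M (Taylor-closed p∈M x w)

-- The ring of Laurent series

module Laurent where

  open Defs using (_+_; _*_; -_; _≈_; 0#; 1#)
  open 𝒜
  open CauchyProduct ℚ.+-*-commutativeRing
    using (_⊛_; ⊛-cong; ⊛-comm; ⊛-assoc; ⊛-distribˡ; ⊛-identityˡ)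
  open ℤ.+-*-Solver using (solve; _:+_; _:-_; _:=_; con)

  coeff-numerator : ∀ f k {n} → k ℤ.+ + order f ≡ + n → coeff f k ≡ numerator f n
  coeff-numerator f k = ≡.cong (extend (numerator f))

  coeff-below : ∀ f k {n} → k ℤ.+ + order f ≡ -[1+ n ] → coeff f k ≡ 0ℚ
  coeff-below f k = ≡.cong (extend (numerator f))

  numerator≡coeff : ∀ f n → numerator f n ≡ coeff f (+ n ℤ.- + order f)
  numerator≡coeff f n = ≡.sym
    (coeff-numerator f (+ n ℤ.- + order f) (solve 2 (λ n N → n :- N :+ N := n) refl (+ n) (+ order f)))

  -- The order of the sum exceeds neither bound too tightly: if even `k + N + M` is negative, then
  -- so are `k + N` and `k + M`, and both coefficients on the right are 0.
  coeff-+ : ∀ f g k → coeff (f + g) k ≡ coeff f k ℚ.+ coeff g k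
  coeff-+ f g k with k ℤ.+ + (order f ℕ.+ order g) in eq
  ... | + n = ≡.cong (λ i → coeff f i ℚ.+ coeff g i)
                (≡.trans (≡.cong (ℤ._- + (order f ℕ.+ order g)) (≡.sym eq))
                  (solve 2 (λ k N → k :+ N :- N := k) refl k (+ (order f ℕ.+ order g))))
  ... | -[1+ n ] = ≡.sym (≡.trans
      (≡.cong₂ ℚ._+_ (coeff-below f k below-f) (coeff-below g k below-g)) (ℚ.+-identityˡ 0ℚ))
    where
    below-f : k ℤ.+ + order f ≡ -[1+ n ℕ.+ order g ]
    below-f = ≡.trans (solve 3 (λ k N M → k :+ N := k :+ (N :+ M) :- M) refl k (+ order f) (+ order g))
                (≡.trans (≡.cong (ℤ._- + order g) eq) (≡.sym (ℤ.neg-distrib-+ (+ suc n) (+ order g))))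
    below-g : k ℤ.+ + order g ≡ -[1+ n ℕ.+ order f ]
    below-g = ≡.trans (solve 3 (λ k N M → k :+ M := k :+ (N :+ M) :- N) refl k (+ order f) (+ order g))
                (≡.trans (≡.cong (ℤ._- + order f) eq) (≡.sym (ℤ.neg-distrib-+ (+ suc n) (+ order f))))

  extend-cong : ∀ {a b} → a ≗ b → extend a ≗ extend b
  extend-cong a≗b (+ n)    = a≗b n
  extend-cong a≗b -[1+ n ] = refl

  extend-map : ∀ (h : ℚ → ℚ) → h 0ℚ ≡ 0ℚ → ∀ a → extend (h ∘ a) ≗ h ∘ extend a
  extend-map h h0 a (+ n)    = refl
  extend-map h h0 a -[1+ n ] = ≡.sym h0

  extend-+ : ∀ a b i → extend (λ n → a n ℚ.+ b n) i ≡ extend a i ℚ.+ extend b i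
  extend-+ a b (+ n)    = refl
  extend-+ a b -[1+ n ] = ≡.sym (ℚ.+-identityˡ 0ℚ)

  coeff-neg : ∀ f k → coeff (- f) k ≡ ℚ.- coeff f k
  coeff-neg f k = extend-map ℚ.-_ refl (numerator f) (k ℤ.+ + order f)

  coeff-0# : ∀ k → coeff 0# k ≡ 0ℚ
  coeff-0# k with k ℤ.+ + 0
  ... | + zero   = refl
  ... | + suc n  = refl
  ... | -[1+ n ] = refl

  +-cong : ∀ {f f′ g g′} → f ≈ f′ → g ≈ g′ → f + g ≈ f′ + g′
  +-cong {f} {f′} {g} {g′} f≈f′ g≈g′ k =
    ≡.trans (coeff-+ f g k) (≡.trans (≡.cong₂ ℚ._+_ (f≈f′ k) (g≈g′ k)) (≡.sym (coeff-+ f′ g′ k)))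

  +-comm : ∀ f g → f + g ≈ g + f
  +-comm f g k = ≡.trans (coeff-+ f g k) (≡.trans (ℚ.+-comm (coeff f k) (coeff g k)) (≡.sym (coeff-+ g f k)))

  +-assoc : ∀ f g h → (f + g) + h ≈ f + (g + h)
  +-assoc f g h k = begin
    coeff (f + g + h) k                          ≡⟨ coeff-+ (f + g) h k ⟩
    coeff (f + g) k ℚ.+ coeff h k                ≡⟨ ≡.cong (ℚ._+ coeff h k) (coeff-+ f g k) ⟩
    coeff f k ℚ.+ coeff g k ℚ.+ coeff h k        ≡⟨ ℚ.+-assoc (coeff f k) (coeff g k) (coeff h k) ⟩
    coeff f k ℚ.+ (coeff g k ℚ.+ coeff h k)      ≡⟨ ≡.cong (coeff f k ℚ.+_) (coeff-+ g h k) ⟨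
    coeff f k ℚ.+ coeff (g + h) k                ≡⟨ coeff-+ f (g + h) k ⟨
    coeff (f + (g + h)) k                        ∎
    where open ≡.≡-Reasoning

  +-identityˡ : ∀ f → 0# + f ≈ f
  +-identityˡ f k = ≡.trans (coeff-+ 0# f k) (≡.trans (≡.cong (ℚ._+ coeff f k) (coeff-0# k)) (ℚ.+-identityˡ _))

  -‿inverseˡ : ∀ f → - f + f ≈ 0#
  -‿inverseˡ f k = ≡.trans (coeff-+ (- f) f k) (≡.trans (≡.cong (ℚ._+ coeff f k) (coeff-neg f k))
                     (≡.trans (ℚ.+-inverseˡ (coeff f k)) (≡.sym (coeff-0# k))))

  numerators : ∀ {N M a b} → N ≡ M → a ≗ b → (z^- N · a) ≈ (z^- M · b)
  numerators {N} refl a≗b k = extend-cong a≗b (k ℤ.+ + N)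

  ≈⇒≗ : ∀ {N a b} → (z^- N · a) ≈ (z^- N · b) → a ≗ b
  ≈⇒≗ {N} {a} {b} f≈g n = ≡.trans (numerator≡coeff (z^- N · a) n)
    (≡.trans (f≈g (+ n ℤ.- + N)) (≡.sym (numerator≡coeff (z^- N · b) n)))

  z·_ : (ℕ → ℚ) → ℕ → ℚ
  (z· a) zero    = 0ℚ
  (z· a) (suc n) = a n

  z^_·_ : ℕ → (ℕ → ℚ) → ℕ → ℚ
  z^ zero  · a = a
  z^ suc m · a = z· (z^ m · a)

  z·-cong : ∀ {a b} → a ≗ b → z· a ≗ z· b
  z·-cong a≗b zero    = refl
  z·-cong a≗b (suc n) = a≗b n

  z·-⊛ : ∀ a b → (z· a) ⊛ b ≗ z· (a ⊛ b)
  z·-⊛ a b zero    = ℚ.*-zeroˡ (b 0)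
  z·-⊛ a b (suc n) = ≡.trans (≡.cong (ℚ._+ (a ⊛ b) n) (ℚ.*-zeroˡ (b (suc n)))) (ℚ.+-identityˡ _)

  z^-⊛ : ∀ m a b → (z^ m · a) ⊛ b ≗ z^ m · (a ⊛ b)
  z^-⊛ zero    a b n = refl
  z^-⊛ (suc m) a b n = ≡.trans (z·-⊛ (z^ m · a) b n) (z·-cong (z^-⊛ m a b) n)

  𝒜-setoid : Setoid 0ℓ 0ℓ
  𝒜-setoid = record
    { Carrier = 𝒜 ; _≈_ = _≈_
    ; isEquivalence = record
      { refl = λ _ → refl ; sym = λ f≈g k → ≡.sym (f≈g k) ; trans = λ f≈g g≈h k → ≡.trans (f≈g k) (g≈h k) }
    }

  open SetoidReasoning 𝒜-setoid

  -- Representatives are not unique; raising their orders to a common value turns equality of series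
  -- into equality of numerators, where the laws of `_⊛_` apply.
  ≈-raise₁ : ∀ N a → (z^- N · a) ≈ (z^- suc N · z· a)
  ≈-raise₁ N a k = ≡.trans (≡.sym (extend-suc (k ℤ.+ + N)))
    (≡.cong (extend (z· a)) (solve 2 (λ k N → con 1ℤ :+ (k :+ N) := k :+ (con 1ℤ :+ N)) refl k (+ N)))
    where
    extend-suc : ∀ i → extend (z· a) (ℤ.suc i) ≡ extend a i
    extend-suc (+ n)        = refl
    extend-suc -[1+ zero  ] = refl
    extend-suc -[1+ suc n ] = refl

  ≈-raise : ∀ m N a → (z^- N · a) ≈ (z^- m ℕ.+ N · (z^ m · a))
  ≈-raise zero    N a = λ _ → refl
  ≈-raise (suc m) N a = λ k → ≡.trans (≈-raise m N a k) (≈-raise₁ (m ℕ.+ N) (z^ m · a) k)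

  *-comm : ∀ f g → f * g ≈ g * f
  *-comm f g = numerators (ℕ.+-comm (order f) (order g)) (⊛-comm (numerator f) (numerator g))

  -- With `N` and `N′` the orders, `f ≈ f′` amounts to `z^ N′ · a ≗ z^ N · a′`. This survives
  -- multiplication by `b`, after which the powers of z are pulled out again.
  *-congʳ : ∀ {f f′} g → f ≈ f′ → f * g ≈ f′ * g
  *-congʳ {f} {f′} g f≈f′ = begin
    f * g                                             ≈⟨ ≈-raise N′ (N ℕ.+ L) (a ⊛ b) ⟩
    z^- N′ ℕ.+ (N ℕ.+ L) · (z^ N′ · (a ⊛ b))          ≈⟨ numerators (x∙yz≈y∙xz N′ N L) za⊛b≗za′⊛b ⟩
    z^- N ℕ.+ (N′ ℕ.+ L) · (z^ N · (a′ ⊛ b))          ≈⟨ ≈-raise N (N′ ℕ.+ L) (a′ ⊛ b) ⟨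
    f′ * g                                            ∎
    where
    open CommutativeSemigroupProperties ℕ.+-commutativeSemigroup using (x∙yz≈y∙xz)
    N = order f
    N′ = order f′
    L = order g
    a = numerator f
    a′ = numerator f′
    b = numerator g
    za≗za′ : z^ N′ · a ≗ z^ N · a′
    za≗za′ = ≈⇒≗ (begin
      z^- N′ ℕ.+ N · (z^ N′ · a)    ≈⟨ ≈-raise N′ N a ⟨
      f                             ≈⟨ f≈f′ ⟩
      f′                            ≈⟨ ≈-raise N N′ a′ ⟩
      z^- N ℕ.+ N′ · (z^ N · a′)    ≈⟨ numerators (ℕ.+-comm N N′) (λ _ → refl) ⟩
      z^- N′ ℕ.+ N · (z^ N · a′)    ∎)
    za⊛b≗za′⊛b : z^ N′ · (a ⊛ b) ≗ z^ N · (a′ ⊛ b)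
    za⊛b≗za′⊛b n = ≡.trans (≡.sym (z^-⊛ N′ a b n)) (≡.trans (⊛-cong za≗za′ (λ _ → refl) n) (z^-⊛ N a′ b n))

  *-cong : ∀ {f f′ g g′} → f ≈ f′ → g ≈ g′ → f * g ≈ f′ * g′
  *-cong {f} {f′} {g} {g′} f≈f′ g≈g′ = begin
    f * g    ≈⟨ *-congʳ g f≈f′ ⟩
    f′ * g   ≈⟨ *-comm f′ g ⟩
    g * f′   ≈⟨ *-congʳ f′ g≈g′ ⟩
    g′ * f′  ≈⟨ *-comm g′ f′ ⟩
    f′ * g′  ∎

  *-assoc : ∀ f g h → (f * g) * h ≈ f * (g * h)
  *-assoc f g h = numerators
    (ℕ.+-assoc (order f) (order g) (order h))
    (⊛-assoc (numerator f) (numerator g) (numerator h))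

  *-identityˡ : ∀ f → 1# * f ≈ f
  *-identityˡ f = numerators refl (⊛-identityˡ {numerator 1#} refl (λ _ → refl) (numerator f))

  +-sameOrder : ∀ N a b → (z^- N · a) + (z^- N · b) ≈ (z^- N · λ n → a n ℚ.+ b n)
  +-sameOrder N a b k = ≡.trans (coeff-+ (z^- N · a) (z^- N · b) k) (≡.sym (extend-+ a b (k ℤ.+ + N)))

  distribˡ : ∀ f g h → f * (g + h) ≈ f * g + f * h
  distribˡ f g h = begin
    f * (g + h)
      ≈⟨ *-cong {f} (λ _ → refl) (+-cong g≈g′ h≈h′) ⟩
    f * (g′ + h′)
      ≈⟨ *-cong {f} (λ _ → refl) (+-sameOrder P b c) ⟩
    f * (z^- P · λ n → b n ℚ.+ c n)
      ≈⟨ numerators refl (⊛-distribˡ (numerator f) b c) ⟩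
    (z^- order f ℕ.+ P · λ n → (numerator f ⊛ b) n ℚ.+ (numerator f ⊛ c) n)
      ≈⟨ +-sameOrder (order f ℕ.+ P) (numerator f ⊛ b) (numerator f ⊛ c) ⟨
    f * g′ + f * h′
      ≈⟨ +-cong (*-cong {f} (λ _ → refl) g≈g′) (*-cong {f} (λ _ → refl) h≈h′) ⟨
    f * g + f * h
      ∎
    where
    P = order h ℕ.+ order g
    b = z^ order h · numerator g
    c = z^ order g · numerator h
    g′ = z^- P · b
    h′ = z^- P · c
    g≈g′ : g ≈ g′
    g≈g′ = ≈-raise (order h) (order g) (numerator g)
    h≈h′ : h ≈ h′
    h≈h′ = begin
      h                                      ≈⟨ ≈-raise (order g) (order h) (numerator h) ⟩
      z^- order g ℕ.+ order h · c            ≈⟨ numerators (ℕ.+-comm (order g) (order h)) (λ _ → refl) ⟩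
      h′                                     ∎

  𝒜-commutativeRing : CommutativeRing 0ℓ 0ℓ
  𝒜-commutativeRing = record
    { Carrier = 𝒜 ; _≈_ = _≈_ ; _+_ = _+_ ; _*_ = _*_ ; -_ = -_ ; 0# = 0# ; 1# = 1#
    ; isCommutativeRing = record
      { isRing = record
        { +-isAbelianGroup = record
          { isGroup = record
            { isMonoid = record
              { isSemigroup = record
                { isMagma = record { isEquivalence = Setoid.isEquivalence 𝒜-setoid ; ∙-cong = +-cong }
                ; assoc = +-assoc
                }
              ; identity = comm∧idˡ⇒id +-comm +-identityˡ
              }
            ; inverse = comm∧invˡ⇒inv +-comm -‿inverseˡ
            ; ⁻¹-cong = λ {f} {g} f≈g k →
                ≡.trans (coeff-neg f k) (≡.trans (≡.cong ℚ.-_ (f≈g k)) (≡.sym (coeff-neg g k)))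
            }
          ; comm = +-comm
          }
        ; *-cong = *-cong
        ; *-assoc = *-assoc
        ; *-identity = comm∧idˡ⇒id *-comm *-identityˡ
        ; distrib = comm∧distrˡ⇒distr +-cong *-comm distribˡ
        }
      ; *-comm = *-comm
      }
    }
    where open Consequences 𝒜-setoid

-- The derivation, and polar and regular series

module LaurentDerivation where

  open Defs using (_+_; _*_; -_; _≈_; 0#; 1#)
  open 𝒜
  open Laurent
  open CommutativeRing 𝒜-commutativeRing using (+-congˡ)
  open CauchyProduct ℚ.+-*-commutativeRing
  open Hurwitz 𝒜-commutativeRing using (_≈ᴴ_; _*ᴴ_; *ᴴ-cong)

  -- The right-hand side does not mention the order, so `∂`, although defined on representatives,
  -- respects `_≈_`.
  coeff-∂ : ∀ f k → coeff (∂ f) k ≡ (ℤ.suc k / 1) ℚ.* coeff f (ℤ.suc k)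
  coeff-∂ f k with k ℤ.+ + suc (order f) in eq
  ... | + n = ≡.cong₂ (λ i c → (i / 1) ℚ.* c) n-N≡1+k (≡.trans (numerator≡coeff f n) (≡.cong (coeff f) n-N≡1+k))
    where
    open ℤ.+-*-Solver
    n-N≡1+k : + n ℤ.- + order f ≡ ℤ.suc k
    n-N≡1+k = ≡.trans (≡.cong (ℤ._- + order f) (≡.sym eq))
      (solve 2 (λ k N → k :+ (con 1ℤ :+ N) :- N := con 1ℤ :+ k) refl k (+ order f))
  ... | -[1+ n ] = ≡.sym (≡.trans (≡.cong (ℤ.suc k / 1 ℚ.*_) (coeff-below f (ℤ.suc k) (≡.trans
      (solve 2 (λ k N → con 1ℤ :+ k :+ N := k :+ (con 1ℤ :+ N)) refl k (+ order f)) eq))) (ℚ.*-zeroʳ (ℤ.suc k / 1)))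
    where open ℤ.+-*-Solver

  ∂-cong : ∀ {f g} → f ≈ g → ∂ f ≈ ∂ g
  ∂-cong {f} {g} f≈g k =
    ≡.trans (coeff-∂ f k) (≡.trans (≡.cong (ℤ.suc k / 1 ℚ.*_) (f≈g (ℤ.suc k))) (≡.sym (coeff-∂ g k)))

  ∂-+ : ∀ f g → ∂ (f + g) ≈ ∂ f + ∂ g
  ∂-+ f g k = begin
    coeff (∂ (f + g)) k                                       ≡⟨ coeff-∂ (f + g) k ⟩
    c ℚ.* coeff (f + g) (ℤ.suc k)                             ≡⟨ ≡.cong (c ℚ.*_) (coeff-+ f g (ℤ.suc k)) ⟩
    c ℚ.* (coeff f (ℤ.suc k) ℚ.+ coeff g (ℤ.suc k))           ≡⟨ ℚ.*-distribˡ-+ c (coeff f (ℤ.suc k)) (coeff g (ℤ.suc k)) ⟩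
    c ℚ.* coeff f (ℤ.suc k) ℚ.+ c ℚ.* coeff g (ℤ.suc k)       ≡⟨ ≡.cong₂ ℚ._+_ (coeff-∂ f k) (coeff-∂ g k) ⟨
    coeff (∂ f) k ℚ.+ coeff (∂ g) k                           ≡⟨ coeff-+ (∂ f) (∂ g) k ⟨
    coeff (∂ f + ∂ g) k                                       ∎
    where
    open ≡.≡-Reasoning
    c = ℤ.suc k / 1

  open SetoidReasoning 𝒜-setoid

  -- For `i + j ≡ n` the exponent splits as `n - (N + M) = (i - N) + (j - M)`, one part for each
  -- factor.
  ∂-* : ∀ f g → ∂ (f * g) ≈ ∂ f * g + f * ∂ g
  ∂-* f g = begin
    ∂ (f * g)
      ≈⟨ numerators refl leibniz ⟩
    (z^- suc (N ℕ.+ M) · λ n → (a′ ⊛ b) n ℚ.+ (a ⊛ b′) n)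
      ≈⟨ +-sameOrder (suc (N ℕ.+ M)) (a′ ⊛ b) (a ⊛ b′) ⟨
    ∂ f * g + (z^- suc (N ℕ.+ M) · (a ⊛ b′))
      ≈⟨ +-congˡ {∂ f * g} (numerators (≡.sym (ℕ.+-suc N M)) λ _ → refl) ⟩
    ∂ f * g + f * ∂ g
      ∎
    where
    N = order f
    M = order g
    a = numerator f
    b = numerator g
    a′ = numerator (∂ f)
    b′ = numerator (∂ g)

    order-+ : ∀ i j → + (i ℕ.+ j) ℤ.- + (N ℕ.+ M) ≡ (+ i ℤ.- + N) ℤ.+ (+ j ℤ.- + M)
    order-+ i j = solve 4 (λ i j N M → i :+ j :- (N :+ M) := (i :- N) :+ (j :- M)) refl (+ i) (+ j) (+ N) (+ M)
      where open ℤ.+-*-Solver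

    term : ∀ n i j → i ℕ.+ j ≡ n →
           ((+ n ℤ.- + (N ℕ.+ M)) / 1) ℚ.* (a i ℚ.* b j) ≡ a′ i ℚ.* b j ℚ.+ a i ℚ.* b′ j
    term n i j refl = ≡.trans
      (≡.cong (ℚ._* (a i ℚ.* b j))
        (≡.trans (≡.cong (_/ 1) (order-+ i j))
                 (/1-homo-+ (+ i ℤ.- + N) (+ j ℤ.- + M))))
      (solve 4 (λ x y a b → (x :+ y) :* (a :* b) := x :* a :* b :+ a :* (y :* b)) refl
        ((+ i ℤ.- + N) / 1) ((+ j ℤ.- + M) / 1) (a i) (b j))
      where open ℚ.+-*-Solver

    leibniz : ∀ n → ((+ n ℤ.- + (N ℕ.+ M)) / 1) ℚ.* (a ⊛ b) n ≡ (a′ ⊛ b) n ℚ.+ (a ⊛ b′) n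
    leibniz n = ≡.trans (*-distribˡ-∑ n ((+ n ℤ.- + (N ℕ.+ M)) / 1) (λ i j → a i ℚ.* b j))
      (≡.trans (∑-congᵢ n (term n)) (∑-+ n (λ i j → a′ i ℚ.* b j) (λ i j → a i ℚ.* b′ j)))

  ∂^-cong : ∀ k {f g} → f ≈ g → ∂^ k f ≈ ∂^ k g
  ∂^-cong zero    f≈g = f≈g
  ∂^-cong (suc k) f≈g = ∂-cong (∂^-cong k f≈g)

  ∂^-+ : ∀ k f g → ∂^ k (f + g) ≈ ∂^ k f + ∂^ k g
  ∂^-+ zero    f g = λ _ → refl
  ∂^-+ (suc k) f g = begin
    ∂ (∂^ k (f + g))       ≈⟨ ∂-cong (∂^-+ k f g) ⟩
    ∂ (∂^ k f + ∂^ k g)    ≈⟨ ∂-+ (∂^ k f) (∂^ k g) ⟩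
    ∂^ (suc k) f + ∂^ (suc k) g  ∎

  ∂^-∂^ : ∀ k j f → ∂^ (k ℕ.+ j) f ≡ ∂^ k (∂^ j f)
  ∂^-∂^ zero    j f = refl
  ∂^-∂^ (suc k) j f = ≡.cong ∂ (∂^-∂^ k j f)

  ∂^-suc : ∀ k f → ∂^ (suc k) f ≡ ∂^ k (∂ f)
  ∂^-suc k f = ≡.trans (≡.cong (λ m → ∂^ m f) (ℕ.+-comm 1 k)) (∂^-∂^ k 1 f)

  -- Taylor expansion is multiplicative. This links the nested products in `φ-dy` with the products
  -- in `Taylor`.
  ∂^-* : ∀ f g → (λ k → ∂^ k (f * g)) ≈ᴴ (λ k → ∂^ k f) *ᴴ (λ k → ∂^ k g)
  ∂^-* f g zero    = λ _ → refl
  ∂^-* f g (suc k) = begin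
    ∂^ (suc k) (f * g)                        ≡⟨ ∂^-suc k (f * g) ⟩
    ∂^ k (∂ (f * g))                          ≈⟨ ∂^-cong k (∂-* f g) ⟩
    ∂^ k (∂ f * g + f * ∂ g)                  ≈⟨ ∂^-+ k (∂ f * g) (f * ∂ g) ⟩
    ∂^ k (∂ f * g) + ∂^ k (f * ∂ g)           ≈⟨ +-cong (∂^-* (∂ f) g k) (∂^-* f (∂ g) k) ⟩
    (T (∂ f) *ᴴ T g) k + (T f *ᴴ T (∂ g)) k   ≈⟨ +-cong
      (*ᴴ-cong {T (∂ f)} {T f ∘ suc} {T g} (λ j i → ≡.cong (λ h → coeff h i) (≡.sym (∂^-suc j f))) (λ _ _ → refl) k)
      (*ᴴ-cong {T f} {T f} {T (∂ g)} {T g ∘ suc} (λ _ _ → refl) (λ j i → ≡.cong (λ h → coeff h i) (≡.sym (∂^-suc j g))) k) ⟩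
    (T f *ᴴ T g) (suc k)                      ∎
    where
    T : 𝒜 → ℕ → 𝒜
    T f k = ∂^ k f

  𝒜₊-resp : ∀ {f g} → f ≈ g → 𝒜₊ f → 𝒜₊ g
  𝒜₊-resp f≈g f∈ k = ≡.trans (≡.sym (f≈g -[1+ k ])) (f∈ k)

  𝒜₊-0# : 𝒜₊ 0#
  𝒜₊-0# k = coeff-0# -[1+ k ]

  𝒜₊-+ : ∀ {f g} → 𝒜₊ f → 𝒜₊ g → 𝒜₊ (f + g)
  𝒜₊-+ {f} {g} f∈ g∈ k = ≡.trans (coeff-+ f g -[1+ k ]) (≡.cong₂ ℚ._+_ (f∈ k) (g∈ k))

  𝒜₊-‿ : ∀ {f} → 𝒜₊ f → 𝒜₊ (- f)
  𝒜₊-‿ {f} f∈ k = ≡.trans (coeff-neg f -[1+ k ]) (≡.cong ℚ.-_ (f∈ k))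

  regularPart : 𝒜 → 𝒜
  regularPart f = z^- 0 · λ n → coeff f (+ n)

  coeff-z^-0 : ∀ a n → coeff (z^- 0 · a) (+ n) ≡ a n
  coeff-z^-0 a n = ≡.cong a (ℕ.+-identityʳ n)

  𝒜₊-regularPart : ∀ f → 𝒜₊ (regularPart f)
  𝒜₊-regularPart f k = refl

  regularPart-≈ : ∀ {f} → 𝒜₊ f → f ≈ regularPart f
  regularPart-≈ {f} f∈ (+ n)    = ≡.sym (coeff-z^-0 (coeff f ∘ +_) n)
  regularPart-≈ {f} f∈ -[1+ k ] = f∈ k

  -- Both factors may be replaced by representatives of order 0, for which the coefficients of the
  -- product at negative exponents compute to 0, and the one at exponent 0 to a single product.
  𝒜₊-* : ∀ {f g} → 𝒜₊ f → 𝒜₊ g → 𝒜₊ (f * g)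
  𝒜₊-* {f} {g} f∈ g∈ k = *-cong {f} {regularPart f} {g} {regularPart g} (regularPart-≈ {f} f∈) (regularPart-≈ {g} g∈) -[1+ k ]

  lim₀-* : ∀ {f g} → 𝒜₊ f → 𝒜₊ g → lim₀ (f * g) ≡ lim₀ f ℚ.* lim₀ g
  lim₀-* {f} {g} f∈ g∈ = *-cong {f} {regularPart f} {g} {regularPart g} (regularPart-≈ {f} f∈) (regularPart-≈ {g} g∈) 0ℤ

  𝒜₋-resp : ∀ {f g} → f ≈ g → 𝒜₋ f → 𝒜₋ g
  𝒜₋-resp f≈g f∈ k = ≡.trans (≡.sym (f≈g (+ k))) (f∈ k)

  𝒜₋-0# : 𝒜₋ 0#
  𝒜₋-0# k = coeff-0# (+ k)

  𝒜₋-+ : ∀ {f g} → 𝒜₋ f → 𝒜₋ g → 𝒜₋ (f + g)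
  𝒜₋-+ {f} {g} f∈ g∈ k = ≡.trans (coeff-+ f g (+ k)) (≡.cong₂ ℚ._+_ (f∈ k) (g∈ k))

  𝒜₋-‿ : ∀ {f} → 𝒜₋ f → 𝒜₋ (- f)
  𝒜₋-‿ {f} f∈ k = ≡.trans (coeff-neg f (+ k)) (≡.cong ℚ.-_ (f∈ k))

  𝒜₋-numerator : ∀ {f} → 𝒜₋ f → ∀ {n} → order f ℕ.≤ n → numerator f n ≡ 0ℚ
  𝒜₋-numerator {f} f∈ {n} N≤n = ≡.trans
    (≡.sym (coeff-numerator f (+ (n ℕ.∸ order f)) (≡.cong +_ (ℕ.m∸n+n≡m N≤n))))
    (f∈ (n ℕ.∸ order f))

  -- The coefficient of zᵏ sums over `i + j = k + (N + M)`, so `i ≥ N` or `j ≥ M`, and a polar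
  -- series has zero numerator from its order onwards.
  𝒜₋-* : ∀ {f g} → 𝒜₋ f → 𝒜₋ g → 𝒜₋ (f * g)
  𝒜₋-* {f} {g} f∈ g∈ k = ≡.trans (∑-congᵢ (k ℕ.+ (N ℕ.+ M)) vanish) (∑-zero (k ℕ.+ (N ℕ.+ M)))
    where
    N = order f
    M = order g
    vanish : ∀ i j → i ℕ.+ j ≡ k ℕ.+ (N ℕ.+ M) → numerator f i ℚ.* numerator g j ≡ 0ℚ
    vanish i j eq with ℕ.≤-<-connex N i
    ... | inj₁ N≤i = ≡.trans (≡.cong (ℚ._* numerator g j) (𝒜₋-numerator {f} f∈ N≤i)) (ℚ.*-zeroˡ (numerator g j))
    ... | inj₂ i<N = ≡.trans (≡.cong (numerator f i ℚ.*_) (𝒜₋-numerator {g} g∈ M≤j)) (ℚ.*-zeroʳ (numerator f i))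
      where
      M≤j : M ℕ.≤ j
      M≤j = ℕ.≮⇒≥ λ j<M → ℕ.<⇒≢ (ℕ.<-≤-trans (ℕ.+-mono-< i<N j<M) (ℕ.m≤n+m (N ℕ.+ M) k)) eq

  𝒜₊∩𝒜₋ : ∀ {f g} → 𝒜₋ f → 𝒜₊ g → f + g ≈ 0# → f ≈ 0# × g ≈ 0#
  𝒜₊∩𝒜₋ {f} {g} f∈ g∈ f+g≈0 = f≈0 , λ k → ≡.trans (≡.sym (ℚ.+-identityˡ (coeff g k)))
      (≡.trans (≡.cong (ℚ._+ coeff g k) (≡.sym (≡.trans (f≈0 k) (coeff-0# k)))) (≡.trans (≡.sym (coeff-+ f g k)) (f+g≈0 k)))
    where
    f≈0 : f ≈ 0#
    f≈0 (+ n)    = ≡.trans (f∈ n) (≡.sym (coeff-0# (+ n)))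
    f≈0 -[1+ n ] = ≡.trans (≡.sym (≡.trans (≡.cong (coeff f -[1+ n ] ℚ.+_) (g∈ n)) (ℚ.+-identityʳ _)))
      (≡.trans (≡.sym (coeff-+ f g -[1+ n ])) (f+g≈0 -[1+ n ]))

-- The Birkhoff factors as characters

Y⇒dy : ∀ {w} → Y w → ∃ λ ks → w ≡ dy ks
Y⇒dy 𝟏     = [] , refl
Y⇒dy (w y) = let k , ks , eq = go w in k ∷ ks , eq
  where
  go : ∀ w → ∃₂ λ k ks → w ∷ʳ 𝐲 ≡ dy (k ∷ ks)
  go []      = 0 , [] , refl
  go (𝐝 ∷ w) = let k , ks , eq = go w in suc k , ks , ≡.cong (𝐝 ∷_) eq
  go (𝐲 ∷ w) = let k , ks , eq = go w in 0 , k ∷ ks , ≡.cong (𝐲 ∷_) eq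

¬Y⇒wd : ∀ w → ¬ Y w → ∃ λ u → w ≡ u ∷ʳ 𝐝
¬Y⇒wd w ¬Yw with initLast w
... | []      = contradiction 𝟏 ¬Yw
... | u ∷ʳ′ 𝐲 = contradiction (u y) ¬Yw
... | u ∷ʳ′ 𝐝 = u , refl

module BirkhoffFactors (B : Birkhoff) where

  open Birkhoff B
  open Laurent using (𝒜-commutativeRing; coeff-+; coeff-neg)
  open LaurentDerivation
  open CommutativeRing 𝒜-commutativeRing hiding (refl; zero)
  open Hurwitz 𝒜-commutativeRing
  open Character 𝒜-commutativeRing
  open SplittingSum 𝒜-commutativeRing
  open GroupProperties +-group using (x∙y⁻¹≈ε⇒x≈y; //-rightDividesˡ)
  open SetoidReasoning setoid

  vanishes-outside-Y : ∀ (α : LinearMap) {w} → ¬ Y w → ⟦ α ⟧ ⟨ w ⟩ ≈ 0#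
  vanishes-outside-Y α {w} ¬Yw with ¬Y⇒wd w ¬Yw
  ... | u , refl = begin
    ⟦ α ⟧ ⟨ u ∷ʳ 𝐝 ⟩   ≈⟨ ⟦⟧-cong (⟨ u ∷ʳ 𝐝 ⟩ , [] , gen u , zero , λ _ → refl) ⟩
    ⟦ α ⟧ []           ≈⟨ 0ᴹ-homo ⟩
    0#                 ∎
    where open LeftModuleMorphisms.IsLeftModuleHomomorphism (isLeftModuleHomomorphism α) using (⟦⟧-cong; 0ᴹ-homo)

  character-outside-Y : ∀ p {w} → ¬ Y w → character p w ≈ 0#
  character-outside-Y p {w} ¬Yw with ¬Y⇒wd w ¬Yw
  ... | u , refl = Taylor-wd p u 0

  ⋆-∑ : ∀ α β w → (α ⋆ β) w ≈ ∑[u⧢v∋ w ] (λ u v → ⟦ α ⟧ ⟨ u ⟩ * ⟦ β ⟧ ⟨ v ⟩)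
  ⋆-∑ α β w = ∑-Δ₀ w vanish
    where
    vanish : ∀ u v → ¬ (Y u × Y v) → ⟦ α ⟧ ⟨ u ⟩ * ⟦ β ⟧ ⟨ v ⟩ ≈ 0#
    vanish u v ¬YY with Y? u
    ... | no ¬Yu = begin
      ⟦ α ⟧ ⟨ u ⟩ * ⟦ β ⟧ ⟨ v ⟩  ≈⟨ *-congʳ {⟦ β ⟧ ⟨ v ⟩} (vanishes-outside-Y α ¬Yu) ⟩
      0# * ⟦ β ⟧ ⟨ v ⟩           ≈⟨ zeroˡ (⟦ β ⟧ ⟨ v ⟩) ⟩
      0#                         ∎
    ... | yes Yu = begin
      ⟦ α ⟧ ⟨ u ⟩ * ⟦ β ⟧ ⟨ v ⟩  ≈⟨ *-congˡ {⟦ α ⟧ ⟨ u ⟩} (vanishes-outside-Y β λ Yv → ¬YY (Yu , Yv)) ⟩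
      ⟦ α ⟧ ⟨ u ⟩ * 0#           ≈⟨ zeroʳ (⟦ α ⟧ ⟨ u ⟩) ⟩
      0#                         ∎

  p p₊ p₋ : ℕ → 𝒜
  p  k = ∂^ k ξ
  p₊ k = regularPart (p k)
  p₋ k = p k - p₊ k

  p₊∈𝒜₊ : ∀ k → 𝒜₊ (p₊ k)
  p₊∈𝒜₊ k = 𝒜₊-regularPart (p k)

  p₋∈𝒜₋ : ∀ k → 𝒜₋ (p₋ k)
  p₋∈𝒜₋ k n = ≡.trans (coeff-+ (p k) (- p₊ k) (+ n)) (≡.trans
    (≡.cong (coeff (p k) (+ n) ℚ.+_) (≡.trans (coeff-neg (p₊ k) (+ n)) (≡.cong ℚ.-_ (coeff-z^-0 (coeff (p k) ∘ +_) n))))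
    (ℚ.+-inverseʳ (coeff (p k) (+ n))))

  p₋+p₊ : p₋ +ᴴ p₊ ≈ᴴ p
  p₋+p₊ k = //-rightDividesˡ (p₊ k) (p k)

  -- The claim covers all derivatives at once because prefixing `dᵏ` shifts the series by `k`.
  Taylor-y : ∀ ks → Taylor p (𝐲 ∷ dy ks) ≈ᴴ λ j → ∂^ j (foldr (λ k g → ξ * ∂^ k g) ξ ks)
  Taylor-y []       j = ℍ.*-identityʳ p j
    where module ℍ = CommutativeRing commutativeRing
  Taylor-y (k ∷ ks) j = begin
    (p *ᴴ Taylor p (dy (k ∷ ks))) j       ≈⟨ *ᴴ-cong {p} {p} (λ _ _ → refl) Taylor-d^y j ⟩
    (p *ᴴ λ i → ∂^ i (∂^ k g)) j          ≈⟨ ∂^-* ξ (∂^ k g) j ⟨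
    ∂^ j (ξ * ∂^ k g)                     ∎
    where
    g = foldr (λ k g → ξ * ∂^ k g) ξ ks
    Taylor-d^y : Taylor p (dy (k ∷ ks)) ≈ᴴ λ i → ∂^ i (∂^ k g)
    Taylor-d^y i = begin
      Taylor p (dy (k ∷ ks)) i            ≡⟨ Taylor-d^ p k (𝐲 ∷ dy ks) i ⟩
      Taylor p (𝐲 ∷ dy ks) (k ℕ.+ i)      ≈⟨ Taylor-y ks (k ℕ.+ i) ⟩
      ∂^ (k ℕ.+ i) g                      ≡⟨ ≡.cong (λ m → ∂^ m g) (ℕ.+-comm k i) ⟩
      ∂^ (i ℕ.+ k) g                      ≡⟨ ∂^-∂^ i k g ⟩
      ∂^ i (∂^ k g)                       ∎

  φ≈character : ∀ {w} → Y w → ⟦ φ ⟧ ⟨ w ⟩ ≈ character p w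
  φ≈character Yw with Y⇒dy Yw
  ... | []     , refl = φ-𝟏
  ... | k ∷ ks , refl = begin
    ⟦ φ ⟧ ⟨ dy (k ∷ ks) ⟩                              ≈⟨ φ-dy k ks ⟩
    ∂^ k (foldr (λ k g → ξ * ∂^ k g) ξ ks)             ≈⟨ Taylor-y ks k ⟨
    Taylor p (𝐲 ∷ dy ks) k                             ≡⟨ ≡.cong (Taylor p (𝐲 ∷ dy ks)) (ℕ.+-identityʳ k) ⟨
    Taylor p (𝐲 ∷ dy ks) (k ℕ.+ 0)                     ≡⟨ Taylor-d^ p k (𝐲 ∷ dy ks) 0 ⟨
    character p (dy (k ∷ ks))                          ∎

  φ₋∈𝒜₋ : ∀ x w → 𝒜₋ (⟦ φ₋ ⟧ ⟨ x ∷ w ⟩)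
  φ₋∈𝒜₋ x w = φ₋-kerε ⟨ x ∷ w ⟩ refl

  -- The relation `φ₋⁻¹ ⋆ φ₋ = ε` expresses the value at a word through values of `φ₋⁻¹` at shorter
  -- words and of `φ₋` at nonempty ones. The auxiliary bound `n` makes this an induction on length.
  φ₋⁻¹∈𝒜₋ : ∀ x w → 𝒜₋ (⟦ φ₋⁻¹ ⟧ ⟨ x ∷ w ⟩)
  φ₋⁻¹∈𝒜₋ x w = go _ x w ℕ.≤-refl
    where
    go : ∀ n x w → length w ℕ.< n → 𝒜₋ (⟦ φ₋⁻¹ ⟧ ⟨ x ∷ w ⟩)
    go (suc n) x w (s≤s w≤n) with Y? (x ∷ w)
    ... | no ¬Yxw = 𝒜₋-resp {0#} (sym {⟦ φ₋⁻¹ ⟧ ⟨ x ∷ w ⟩} (vanishes-outside-Y φ₋⁻¹ ¬Yxw)) 𝒜₋-0#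
    ... | yes Yxw = 𝒜₋-resp { - (S - F (x ∷ w) [])} isolate
          (𝒜₋-‿ {S - F (x ∷ w) []} (∑-leading {M = 𝒜₋}
            (λ {a} {b} → 𝒜₋-resp {a} {b}) (λ {a} {b} → 𝒜₋-+ {a} {b}) 𝒜₋-0# (x ∷ w) {F} F∈𝒜₋))
      where
      F = λ u v → ⟦ φ₋⁻¹ ⟧ ⟨ u ⟩ * ⟦ φ₋ ⟧ ⟨ v ⟩
      S = ∑[u⧢v∋ x ∷ w ] F
      F∈𝒜₋ : ∀ u v → length u ℕ.< length (x ∷ w) → length u ℕ.+ length v ≡ length (x ∷ w) → 𝒜₋ (F u v)
      -- Only a `u` of full length pairs with the empty word, and `∑-leading` has split that term
      -- off; so `φ₋` is evaluated only where it is polar.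
      F∈𝒜₋ u       []       u<xw eq = contradiction (≡.trans (≡.sym (ℕ.+-identityʳ _)) eq) (ℕ.<⇒≢ u<xw)
      F∈𝒜₋ []      (x′ ∷ v) _    _  = 𝒜₋-resp {⟦ φ₋ ⟧ ⟨ x′ ∷ v ⟩} (begin
        ⟦ φ₋ ⟧ ⟨ x′ ∷ v ⟩           ≈⟨ *-identityˡ (⟦ φ₋ ⟧ ⟨ x′ ∷ v ⟩) ⟨
        1# * ⟦ φ₋ ⟧ ⟨ x′ ∷ v ⟩      ≈⟨ *-congʳ {⟦ φ₋ ⟧ ⟨ x′ ∷ v ⟩} φ₋⁻¹-𝟏 ⟨
        F [] (x′ ∷ v)               ∎) (φ₋∈𝒜₋ x′ v)
      F∈𝒜₋ (x″ ∷ u) (x′ ∷ v) (s≤s u<w) _ = 𝒜₋-* {⟦ φ₋⁻¹ ⟧ ⟨ x″ ∷ u ⟩} {⟦ φ₋ ⟧ ⟨ x′ ∷ v ⟩}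
        (go n x″ u (ℕ.<-≤-trans u<w w≤n)) (φ₋∈𝒜₋ x′ v)
      isolate : - (S - F (x ∷ w) []) ≈ ⟦ φ₋⁻¹ ⟧ ⟨ x ∷ w ⟩
      isolate = begin
        - (S - F (x ∷ w) [])                    ≈⟨ -‿cong {S - F (x ∷ w) []} (+-congʳ { - F (x ∷ w) []} (begin
                                                     S                 ≈⟨ ⋆-∑ φ₋⁻¹ φ₋ (x ∷ w) ⟨
                                                     (φ₋⁻¹ ⋆ φ₋) (x ∷ w) ≈⟨ φ₋⁻¹-inverseˡ Yxw ⟩
                                                     0#                ∎)) ⟩
        - (0# - F (x ∷ w) [])                   ≈⟨ -‿cong {0# - F (x ∷ w) []} (+-identityˡ (- F (x ∷ w) [])) ⟩
        - (- F (x ∷ w) [])                      ≈⟨ GroupProperties.⁻¹-involutive +-group (F (x ∷ w) []) ⟩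
        ⟦ φ₋⁻¹ ⟧ ⟨ x ∷ w ⟩ * ⟦ φ₋ ⟧ ⟨ [] ⟩      ≈⟨ *-congˡ {⟦ φ₋⁻¹ ⟧ ⟨ x ∷ w ⟩} φ₋-𝟏 ⟩
        ⟦ φ₋⁻¹ ⟧ ⟨ x ∷ w ⟩ * 1#                 ≈⟨ *-identityʳ (⟦ φ₋⁻¹ ⟧ ⟨ x ∷ w ⟩) ⟩
        ⟦ φ₋⁻¹ ⟧ ⟨ x ∷ w ⟩                      ∎

  Taylor-p₊∈𝒜₊ : ∀ x w k → 𝒜₊ (Taylor p₊ (x ∷ w) k)
  Taylor-p₊∈𝒜₊ = Taylor-closed {M = 𝒜₊} (λ {a} {b} → 𝒜₊-resp {a} {b}) 𝒜₊-0#
    (λ {a} {b} → 𝒜₊-+ {a} {b}) (λ {a} {b} → 𝒜₊-* {a} {b}) p₊∈𝒜₊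

  Taylor-p₋∈𝒜₋ : ∀ x w k → 𝒜₋ (Taylor p₋ (x ∷ w) k)
  Taylor-p₋∈𝒜₋ = Taylor-closed {M = 𝒜₋} (λ {a} {b} → 𝒜₋-resp {a} {b}) 𝒜₋-0#
    (λ {a} {b} → 𝒜₋-+ {a} {b}) (λ {a} {b} → 𝒜₋-* {a} {b}) p₋∈𝒜₋

  φ₊-𝟏 : ⟦ φ₊ ⟧ ⟨ [] ⟩ ≈ 1#
  φ₊-𝟏 = begin
    ⟦ φ₊ ⟧ ⟨ [] ⟩                         ≈⟨ *-identityˡ (⟦ φ₊ ⟧ ⟨ [] ⟩) ⟨
    1# * ⟦ φ₊ ⟧ ⟨ [] ⟩                    ≈⟨ *-congʳ {⟦ φ₊ ⟧ ⟨ [] ⟩} φ₋⁻¹-𝟏 ⟨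
    ⟦ φ₋⁻¹ ⟧ ⟨ [] ⟩ * ⟦ φ₊ ⟧ ⟨ [] ⟩       ≈⟨ ⋆-∑ φ₋⁻¹ φ₊ [] ⟨
    (φ₋⁻¹ ⋆ φ₊) []                        ≈⟨ φ≈φ₋⁻¹⋆φ₊ 𝟏 ⟨
    ⟦ φ ⟧ ⟨ [] ⟩                          ≈⟨ φ-𝟏 ⟩
    1#                                    ∎

  -- The two claims form one induction: `∑-*-determines` needs both at all shorter words and yields
  -- only the sum of the two errors, which `𝒜₊∩𝒜₋` then separates.
  birkhoff-characters : ∀ w → ⟦ φ₋⁻¹ ⟧ ⟨ w ⟩ ≈ character p₋ w × ⟦ φ₊ ⟧ ⟨ w ⟩ ≈ character p₊ w
  birkhoff-characters w = go _ w ℕ.≤-refl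
    where
    go : ∀ n w → length w ℕ.< n → ⟦ φ₋⁻¹ ⟧ ⟨ w ⟩ ≈ character p₋ w × ⟦ φ₊ ⟧ ⟨ w ⟩ ≈ character p₊ w
    go (suc n) []      _ = φ₋⁻¹-𝟏 , φ₊-𝟏
    go (suc n) (x ∷ w) (s≤s w<n) with Y? (x ∷ w)
    -- The factorisation of `φ` is given on `Y` only; elsewhere all values are 0.
    ... | no ¬Yxw = both-vanish φ₋⁻¹ p₋ , both-vanish φ₊ p₊
      where
      both-vanish : ∀ α q → ⟦ α ⟧ ⟨ x ∷ w ⟩ ≈ character q (x ∷ w)
      both-vanish α q = begin
        ⟦ α ⟧ ⟨ x ∷ w ⟩         ≈⟨ vanishes-outside-Y α ¬Yxw ⟩
        0#                      ≈⟨ character-outside-Y q ¬Yxw ⟨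
        character q (x ∷ w)     ∎
    ... | yes Yxw =
      let e₋≈0 , e₊≈0 = 𝒜₊∩𝒜₋ {e₋} {e₊} e₋∈𝒜₋ e₊∈𝒜₊
            (∑-*-determines (x ∷ w) {λ u → ⟦ φ₋⁻¹ ⟧ ⟨ u ⟩} {character p₋} {λ v → ⟦ φ₊ ⟧ ⟨ v ⟩} {character p₊}
              (λ u u<xw → proj₁ (go n u (ℕ.<-≤-trans u<xw w<n))) (λ v v<xw → proj₂ (go n v (ℕ.<-≤-trans v<xw w<n)))
              (λ _ → refl) φ₊-𝟏 factorisations)
      in x∙y⁻¹≈ε⇒x≈y (⟦ φ₋⁻¹ ⟧ ⟨ x ∷ w ⟩) (character p₋ (x ∷ w)) e₋≈0 ,
         x∙y⁻¹≈ε⇒x≈y (⟦ φ₊ ⟧ ⟨ x ∷ w ⟩) (character p₊ (x ∷ w)) e₊≈0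
      where
      e₋ = ⟦ φ₋⁻¹ ⟧ ⟨ x ∷ w ⟩ - character p₋ (x ∷ w)
      e₊ = ⟦ φ₊ ⟧ ⟨ x ∷ w ⟩ - character p₊ (x ∷ w)
      e₋∈𝒜₋ : 𝒜₋ e₋
      e₋∈𝒜₋ = 𝒜₋-+ {⟦ φ₋⁻¹ ⟧ ⟨ x ∷ w ⟩} { - character p₋ (x ∷ w)} (φ₋⁻¹∈𝒜₋ x w)
        (𝒜₋-‿ {character p₋ (x ∷ w)} (Taylor-p₋∈𝒜₋ x w 0))
      e₊∈𝒜₊ : 𝒜₊ e₊
      e₊∈𝒜₊ = 𝒜₊-+ {⟦ φ₊ ⟧ ⟨ x ∷ w ⟩} { - character p₊ (x ∷ w)} (φ₊-𝒜₊ ⟨ x ∷ w ⟩)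
        (𝒜₊-‿ {character p₊ (x ∷ w)} (Taylor-p₊∈𝒜₊ x w 0))
      factorisations : ∑[u⧢v∋ x ∷ w ] (λ u v → ⟦ φ₋⁻¹ ⟧ ⟨ u ⟩ * ⟦ φ₊ ⟧ ⟨ v ⟩)
                     ≈ ∑[u⧢v∋ x ∷ w ] (λ u v → character p₋ u * character p₊ v)
      factorisations = begin
        ∑[u⧢v∋ x ∷ w ] (λ u v → ⟦ φ₋⁻¹ ⟧ ⟨ u ⟩ * ⟦ φ₊ ⟧ ⟨ v ⟩)    ≈⟨ ⋆-∑ φ₋⁻¹ φ₊ (x ∷ w) ⟨
        (φ₋⁻¹ ⋆ φ₊) (x ∷ w)                                        ≈⟨ φ≈φ₋⁻¹⋆φ₊ Yxw ⟨
        ⟦ φ ⟧ ⟨ x ∷ w ⟩                                            ≈⟨ φ≈character Yxw ⟩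
        character p (x ∷ w)                                        ≈⟨ Taylor-cong p₋+p₊ (x ∷ w) 0 ⟨
        character (p₋ +ᴴ p₊) (x ∷ w)                               ≈⟨ character-+ p₋ p₊ (x ∷ w) ⟩
        ∑[u⧢v∋ x ∷ w ] (λ u v → character p₋ u * character p₊ v)   ∎

-- Binomial coefficients and factorials

binomial-factorials : ∀ i j → ((i ℕ.+ j) C i) ℕ.* (i ! ℕ.* j !) ≡ (i ℕ.+ j) !
binomial-factorials i j = begin
  ((i ℕ.+ j) C i) ℕ.* (i ! ℕ.* j !)
    ≡⟨ ≡.cong (λ m → ((i ℕ.+ j) C i) ℕ.* (i ! ℕ.* m !)) (ℕ.m+n∸m≡n i j) ⟨
  ((i ℕ.+ j) C i) ℕ.* (i ! ℕ.* (i ℕ.+ j ℕ.∸ i) !)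
    ≡⟨ ≡.cong (ℕ._* (i ! ℕ.* (i ℕ.+ j ℕ.∸ i) !)) (nCk≡n!/k![n-k]! (ℕ.m≤m+n i j)) ⟩
  _
    ≡⟨ m/n*n≡m (k![n∸k]!∣n! (ℕ.m≤m+n i j)) ⟩
  (i ℕ.+ j) !  ∎
  where
  open ≡.≡-Reasoning
  instance _ = i !* (i ℕ.+ j ℕ.∸ i) !≢0

-- These weights turn a binomial convolution of sequences into the product of their generating
-- series.
binomial-/! : ∀ i j → (-1ℤ ℤ.^ (i ℕ.+ j) /! (i ℕ.+ j)) ℚ.* (+ ((i ℕ.+ j) C i) / 1)
                    ≡ (-1ℤ ℤ.^ i /! i) ℚ.* (-1ℤ ℤ.^ j /! j)
binomial-/! i j = begin
  (-1ℤ ℤ.^ (i ℕ.+ j) /! (i ℕ.+ j)) ℚ.* (+ c / 1)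
    ≡⟨ /-*-/ (-1ℤ ℤ.^ (i ℕ.+ j)) (+ c) ((i ℕ.+ j) !) 1 ⟩
  (-1ℤ ℤ.^ (i ℕ.+ j) ℤ.* + c) / ((i ℕ.+ j) ! ℕ.* 1)
    ≡⟨ /-≡ (-1ℤ ℤ.^ (i ℕ.+ j) ℤ.* + c) (-1ℤ ℤ.^ i ℤ.* -1ℤ ℤ.^ j) ((i ℕ.+ j) ! ℕ.* 1) (i ! ℕ.* j !) cross ⟩
  (-1ℤ ℤ.^ i ℤ.* -1ℤ ℤ.^ j) / (i ! ℕ.* j !)
    ≡⟨ /-*-/ (-1ℤ ℤ.^ i) (-1ℤ ℤ.^ j) (i !) (j !) ⟨
  (-1ℤ ℤ.^ i /! i) ℚ.* (-1ℤ ℤ.^ j /! j)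
    ∎
  where
  open ≡.≡-Reasoning
  c = (i ℕ.+ j) C i
  instance
    _ = i !≢0
    _ = j !≢0
    _ = (i ℕ.+ j) !≢0
    _ = i !* j !≢0
    _ = ℕ.m*n≢0 ((i ℕ.+ j) !) 1
  cross : -1ℤ ℤ.^ (i ℕ.+ j) ℤ.* + c ℤ.* + (i ! ℕ.* j !) ≡ -1ℤ ℤ.^ i ℤ.* -1ℤ ℤ.^ j ℤ.* + ((i ℕ.+ j) ! ℕ.* 1)
  cross = begin
    -1ℤ ℤ.^ (i ℕ.+ j) ℤ.* + c ℤ.* + (i ! ℕ.* j !)                ≡⟨ ℤ.*-assoc (-1ℤ ℤ.^ (i ℕ.+ j)) (+ c) _ ⟩
    -1ℤ ℤ.^ (i ℕ.+ j) ℤ.* (+ c ℤ.* + (i ! ℕ.* j !))              ≡⟨ ≡.cong₂ ℤ._*_ (ℤ.^-distribˡ-+-* -1ℤ i j)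
      (≡.trans (≡.sym (ℤ.pos-* c _)) (≡.cong +_ (≡.trans (binomial-factorials i j) (≡.sym (ℕ.*-identityʳ _))))) ⟩
    -1ℤ ℤ.^ i ℤ.* -1ℤ ℤ.^ j ℤ.* + ((i ℕ.+ j) ! ℕ.* 1)            ∎

-- For `a = (-1)ⁿ` this says that -∂ₓ takes (-x)ⁿ⁺¹/(n+1)! to (-x)ⁿ/n!.
/!-suc : ∀ a n → (-1ℤ / 1) ℚ.* ((+ suc n / 1) ℚ.* ((-1ℤ ℤ.* a) /! suc n)) ≡ a /! n
/!-suc a n = begin
  (-1ℤ / 1) ℚ.* ((+ suc n / 1) ℚ.* ((-1ℤ ℤ.* a) /! suc n))
    ≡⟨ ≡.cong ((-1ℤ / 1) ℚ.*_) (/-*-/ (+ suc n) (-1ℤ ℤ.* a) 1 (suc n !)) ⟩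
  (-1ℤ / 1) ℚ.* ((+ suc n ℤ.* (-1ℤ ℤ.* a)) / (1 ℕ.* suc n !))
    ≡⟨ /-*-/ -1ℤ (+ suc n ℤ.* (-1ℤ ℤ.* a)) 1 (1 ℕ.* suc n !) ⟩
  (-1ℤ ℤ.* (+ suc n ℤ.* (-1ℤ ℤ.* a))) / (1 ℕ.* (1 ℕ.* suc n !))
    ≡⟨ /-≡ (-1ℤ ℤ.* (+ suc n ℤ.* (-1ℤ ℤ.* a))) a (1 ℕ.* (1 ℕ.* suc n !)) (n !) cross ⟩
  a /! n
    ∎
  where
  open ≡.≡-Reasoning
  instance
    _ = n !≢0
    _ = suc n !≢0
    _ = ℕ.m*n≢0 1 (suc n !)
    _ = ℕ.m*n≢0 1 (1 ℕ.* suc n !)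
  cross : -1ℤ ℤ.* (+ suc n ℤ.* (-1ℤ ℤ.* a)) ℤ.* + (n !) ≡ a ℤ.* + (1 ℕ.* (1 ℕ.* suc n !))
  cross = begin
    -1ℤ ℤ.* (+ suc n ℤ.* (-1ℤ ℤ.* a)) ℤ.* + (n !)
      ≡⟨ solve 3 (λ s a f → con -1ℤ :* (s :* (con -1ℤ :* a)) :* f := a :* (s :* f)) refl (+ suc n) a (+ (n !)) ⟩
    a ℤ.* (+ suc n ℤ.* + (n !))
      ≡⟨ ≡.cong (a ℤ.*_) (ℤ.pos-* (suc n) (n !)) ⟨
    a ℤ.* + (suc n !)
      ≡⟨ ≡.cong (λ m → a ℤ.* + m) (≡.trans (ℕ.*-identityˡ _) (ℕ.*-identityˡ _)) ⟨
    a ℤ.* + (1 ℕ.* (1 ℕ.* suc n !))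
      ∎
    where open ℤ.+-*-Solver

module RationalHurwitz where

  open Hurwitz ℚ.+-*-commutativeRing using (_*ᴴ_)

  -- Pascal's rule: the term with `f (suc i)` receives `n C i` from differentiating `f` and
  -- `n C suc i` from differentiating `g`.
  *ᴴ-binomial : ∀ f g n → (f *ᴴ g) n ≡ ∑[i+j≡ n ] λ i j → (+ (n C i) / 1) ℚ.* f i ℚ.* g j
  *ᴴ-binomial f g zero    = ≡.cong (ℚ._* g 0) (≡.sym (ℚ.*-identityˡ (f 0)))
  *ᴴ-binomial f g (suc n) = begin
    (f ∘ suc *ᴴ g) n ℚ.+ (f *ᴴ g ∘ suc) n
      ≡⟨ ≡.cong₂ ℚ._+_ (*ᴴ-binomial (f ∘ suc) g n) (*ᴴ-binomial f (g ∘ suc) n) ⟩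
    ∑ n (λ i j → c n i ℚ.* f (suc i) ℚ.* g j) ℚ.+ ∑ n (λ i j → G i (suc j))
      ≡⟨ ≡.cong (∑ n (λ i j → c n i ℚ.* f (suc i) ℚ.* g j) ℚ.+_) shift ⟩
    ∑ n (λ i j → c n i ℚ.* f (suc i) ℚ.* g j) ℚ.+ (G 0 (suc n) ℚ.+ ∑ n (λ i j → G (suc i) j))
      ≡⟨ x∙yz≈y∙xz (∑ n (λ i j → c n i ℚ.* f (suc i) ℚ.* g j)) (G 0 (suc n)) (∑ n (λ i j → G (suc i) j)) ⟩
    G 0 (suc n) ℚ.+ (∑ n (λ i j → c n i ℚ.* f (suc i) ℚ.* g j) ℚ.+ ∑ n (λ i j → G (suc i) j))
      ≡⟨ ≡.cong (G 0 (suc n) ℚ.+_) (≡.trans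
           (≡.sym (∑-+ n (λ i j → c n i ℚ.* f (suc i) ℚ.* g j) (λ i j → G (suc i) j)))
           (∑-cong n pascal)) ⟩
    ∑ (suc n) (λ i j → c (suc n) i ℚ.* f i ℚ.* g j)
      ∎
    where
    open ≡.≡-Reasoning
    open CauchyProduct ℚ.+-*-commutativeRing using (∑; ∑-cong; ∑-+; ∑-last)
    open CommutativeSemigroupProperties (CommutativeRing.+-commutativeSemigroup ℚ.+-*-commutativeRing) using (x∙yz≈y∙xz)
    c : ℕ → ℕ → ℚ
    c n i = + (n C i) / 1
    G : ℕ → ℕ → ℚ
    G i j = c n i ℚ.* f i ℚ.* g j
    -- Since `n C suc n` is 0, this term may be added to complete the antidiagonal of `suc n`, which
    -- `shift` then opens at `i = 0`.
    G-last : G (suc n) 0 ≡ 0ℚ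
    G-last = ≡.trans (≡.cong (λ m → (+ m / 1) ℚ.* f (suc n) ℚ.* g 0) (k>n⇒nCk≡0 (ℕ.n<1+n n)))
               (≡.trans (≡.cong (ℚ._* g 0) (ℚ.*-zeroˡ (f (suc n)))) (ℚ.*-zeroˡ (g 0)))
    shift : ∑ n (λ i j → G i (suc j)) ≡ G 0 (suc n) ℚ.+ ∑ n (λ i j → G (suc i) j)
    shift = ≡.sym (≡.trans (∑-last n G) (≡.trans (≡.cong (∑ n (λ i j → G i (suc j)) ℚ.+_) G-last) (ℚ.+-identityʳ _)))
    pascal : ∀ i j → c n i ℚ.* f (suc i) ℚ.* g j ℚ.+ G (suc i) j ≡ c (suc n) (suc i) ℚ.* f (suc i) ℚ.* g j
    pascal i j = ≡.trans
      (solve 4 (λ a b x y → a :* x :* y :+ b :* x :* y := (a :+ b) :* x :* y) refl (c n i) (c n (suc i)) (f (suc i)) (g j))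
      (≡.cong (λ a → a ℚ.* f (suc i) ℚ.* g j) (≡.trans (≡.sym (/1-homo-+ (+ (n C i)) (+ (n C suc i))))
        (≡.cong (λ m → + m / 1) (nCk+nC[k+1]≡[n+1]C[k+1] n i))))
      where open ℚ.+-*-Solver

-- The recursion for the renormalized values

module ZetaValues (B : Birkhoff) where

  open Laurent using (𝒜-commutativeRing; coeff-+)
  open LaurentDerivation
  open RationalHurwitz using (*ᴴ-binomial)
  open Hurwitz ℚ.+-*-commutativeRing using (_*ᴴ_)
  open BirkhoffFactors B
  open Character 𝒜-commutativeRing
  open CauchyProduct ℚ.+-*-commutativeRing using (∑-cong)
  module 𝒜ᴴ = Hurwitz 𝒜-commutativeRing
  open ≡.≡-Reasoning

  -- On `𝒜₊` the limit is additive and multiplicative, so it commutes with the exponential product.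
  lim₀-*ᴴ : ∀ {f g} → (∀ n → 𝒜₊ (f n)) → (∀ n → 𝒜₊ (g n)) → lim₀ ∘ (f 𝒜ᴴ.*ᴴ g) ≗ (lim₀ ∘ f) *ᴴ (lim₀ ∘ g)
  lim₀-*ᴴ {f} {g} f∈ g∈ zero    = lim₀-* {f 0} {g 0} (f∈ 0) (g∈ 0)
  lim₀-*ᴴ {f} {g} f∈ g∈ (suc n) = ≡.trans (coeff-+ ((f ∘ suc 𝒜ᴴ.*ᴴ g) n) ((f 𝒜ᴴ.*ᴴ g ∘ suc) n) 0ℤ)
    (≡.cong₂ ℚ._+_ (lim₀-*ᴴ {f ∘ suc} {g} (f∈ ∘ suc) g∈ n) (lim₀-*ᴴ {f} {g ∘ suc} f∈ (g∈ ∘ suc) n))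

  Taylor-dy∈𝒜₊ : ∀ k ks j → 𝒜₊ (Taylor p₊ (dy (k ∷ ks)) j)
  Taylor-dy∈𝒜₊ zero    ks = Taylor-p₊∈𝒜₊ 𝐲 (dy ks)
  Taylor-dy∈𝒜₊ (suc k) ks = Taylor-p₊∈𝒜₊ 𝐝 (dy (k ∷ ks))

  reverse-∷ʳ : ∀ (ks : List ℕ) k → reverse (ks ∷ʳ k) ≡ k ∷ reverse ks
  reverse-∷ʳ ks k = reverse-++ ks [ k ]

  -- The word lists the arguments in reverse, so the last argument is the leading power of d, that
  -- is, the index into the Taylor series of the remaining word.
  ζ-EMS-Taylor : ∀ ks k → ζ-EMS B (ks ∷ʳ k) ≡ lim₀ (Taylor p₊ (𝐲 ∷ dy (reverse ks)) k)
  ζ-EMS-Taylor ks k = begin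
    ζ-EMS B (ks ∷ʳ k)
      ≡⟨ proj₂ (birkhoff-characters (dy (reverse (ks ∷ʳ k)))) 0ℤ ⟩
    lim₀ (Taylor p₊ (dy (reverse (ks ∷ʳ k))) 0)
      ≡⟨ ≡.cong (λ ls → lim₀ (Taylor p₊ (dy ls) 0)) (reverse-∷ʳ ks k) ⟩
    lim₀ (Taylor p₊ (dy (k ∷ reverse ks)) 0)
      ≡⟨ ≡.cong lim₀ (Taylor-d^ p₊ k (𝐲 ∷ dy (reverse ks)) 0) ⟩
    lim₀ (Taylor p₊ (𝐲 ∷ dy (reverse ks)) (k ℕ.+ 0))
      ≡⟨ ≡.cong (λ m → lim₀ (Taylor p₊ (𝐲 ∷ dy (reverse ks)) m)) (ℕ.+-identityʳ k) ⟩
    lim₀ (Taylor p₊ (𝐲 ∷ dy (reverse ks)) k)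
      ∎

  ζ-EMS-recursion : ∀ ks k n →
    ζ-EMS B (ks ∷ʳ k ∷ʳ n) ≡ ∑[i+j≡ n ] (λ i j → (+ (n C i) / 1) ℚ.* ζ-EMS B (i ∷ []) ℚ.* ζ-EMS B (ks ∷ʳ (k ℕ.+ j)))
  ζ-EMS-recursion ks k n = begin
    ζ-EMS B (ks ∷ʳ k ∷ʳ n)
      ≡⟨ ζ-EMS-Taylor (ks ∷ʳ k) n ⟩
    lim₀ (Taylor p₊ (𝐲 ∷ dy (reverse (ks ∷ʳ k))) n)
      ≡⟨ ≡.cong (λ ls → lim₀ (Taylor p₊ (𝐲 ∷ dy ls) n)) (reverse-∷ʳ ks k) ⟩
    lim₀ ((p₊ 𝒜ᴴ.*ᴴ T) n)
      ≡⟨ lim₀-*ᴴ {p₊} {T} p₊∈𝒜₊ (Taylor-dy∈𝒜₊ k (reverse ks)) n ⟩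
    ((lim₀ ∘ p₊) *ᴴ (lim₀ ∘ T)) n
      ≡⟨ *ᴴ-binomial (lim₀ ∘ p₊) (lim₀ ∘ T) n ⟩
    ∑[i+j≡ n ] (λ i j → (+ (n C i) / 1) ℚ.* lim₀ (p₊ i) ℚ.* lim₀ (T j))
      ≡⟨ ∑-cong n (λ i j → ≡.cong₂ (λ a b → (+ (n C i) / 1) ℚ.* a ℚ.* b) (first i) (second j)) ⟩
    ∑[i+j≡ n ] (λ i j → (+ (n C i) / 1) ℚ.* ζ-EMS B (i ∷ []) ℚ.* ζ-EMS B (ks ∷ʳ (k ℕ.+ j)))
      ∎
    where
    -- Since this word starts with `dᵏ`, its series is one shifted by `k`, which is the origin of
    -- the argument `k + j`.
    T : ℕ → 𝒜
    T = Taylor p₊ (dy (k ∷ reverse ks))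
    first : ∀ i → lim₀ (p₊ i) ≡ ζ-EMS B (i ∷ [])
    first i = ≡.sym (≡.trans (ζ-EMS-Taylor [] i) (CommutativeRing.*-identityʳ 𝒜ᴴ.commutativeRing p₊ i 0ℤ))
    second : ∀ j → lim₀ (T j) ≡ ζ-EMS B (ks ∷ʳ (k ℕ.+ j))
    second j = ≡.trans (≡.cong lim₀ (Taylor-d^ p₊ k (𝐲 ∷ dy (reverse ks)) j)) (≡.sym (ζ-EMS-Taylor ks (k ℕ.+ j)))

-- Generating functions

module GeneratingFunctions {c ℓ} (K : CommutativeRing c ℓ) (ι : ℚ → CommutativeRing.Carrier K)
  (ι-homo : IsRingHomomorphism ℚ.+-*-rawRing (CommutativeRing.rawRing K) ι) (B : Birkhoff) where

  open PowerSeries K ι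
  open CommutativeRing K hiding (zero) renaming (refl to ≈-refl)
  open CauchyProduct K using (∑-cong; *-distribˡ-∑)
  open CommutativeSemigroupProperties *-commutativeSemigroup using (x∙yz≈y∙xz)
  open IsRingHomomorphism ι-homo using (+-homo; *-homo; 1#-homo)
  open ZetaValues B
  open SetoidReasoning setoid

  ι-cong : ∀ {a b} → a ≡ b → ι a ≈ ι b
  ι-cong a≡b = reflexive (≡.cong ι a≡b)

  ι-∑ : ∀ n f → ι (∑[i+j≡ n ] f) ≈ antidiagonalSum _+_ n (λ i j → ι (f i j))
  ι-∑ zero    f = ≈-refl
  ι-∑ (suc n) f = trans (+-homo _ _) (+-congˡ (ι-∑ n _))

  sign : ℕ → ℚ
  sign k = (-1ℤ ℤ.^ k) / 1

  *ˣ-cong : ∀ f {g h} → g ≈ˣ h → f *ˣ g ≈ˣ f *ˣ h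
  *ˣ-cong f g≈h n = ∑-cong n λ i j → *-congˡ (g≈h j)

  *ˣ-·ˣ : ∀ a f g → f *ˣ (a ·ˣ g) ≈ˣ a ·ˣ (f *ˣ g)
  *ˣ-·ˣ a f g n = trans (∑-cong n λ i j → x∙yz≈y∙xz (f i) (ι a) (g j)) (sym (*-distribˡ-∑ n (ι a) _))

  ·ˣ-·ˣ : ∀ a b f → a ·ˣ (b ·ˣ f) ≈ˣ (a ℚ.* b) ·ˣ f
  ·ˣ-·ˣ a b f n = trans (sym (*-assoc _ _ _)) (*-congʳ (sym (*-homo a b)))

  ∂ˣ-cong : ∀ {f g} → f ≈ˣ g → ∂ˣ f ≈ˣ ∂ˣ g
  ∂ˣ-cong f≈g n = *-congˡ (f≈g (suc n))

  ∂ˣ-·ˣ : ∀ a f → ∂ˣ (a ·ˣ f) ≈ˣ a ·ˣ ∂ˣ f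
  ∂ˣ-·ˣ a f n = x∙yz≈y∙xz _ _ _

  ∂ˣ^-cong : ∀ k {f g} → f ≈ˣ g → ∂ˣ^ k f ≈ˣ ∂ˣ^ k g
  ∂ˣ^-cong zero    f≈g = f≈g
  ∂ˣ^-cong (suc k) f≈g = ∂ˣ-cong (∂ˣ^-cong k f≈g)

  ∂ˣ^-·ˣ : ∀ k a f → ∂ˣ^ k (a ·ˣ f) ≈ˣ a ·ˣ ∂ˣ^ k f
  ∂ˣ^-·ˣ zero    a f n = ≈-refl
  ∂ˣ^-·ˣ (suc k) a f n = trans (∂ˣ-cong (∂ˣ^-·ˣ k a f) n) (∂ˣ-·ˣ a (∂ˣ^ k f) n)

  -- 𝔥 B ks is the series signedEGF z with z(k) = ζ_EMS(−k₁,…,−kₙ₋₁,−k).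
  signedEGF : (ℕ → ℚ) → K[[x]]
  signedEGF z k = ι ((-1ℤ ℤ.^ k) /! k ℚ.* z k)

  signedEGF-cong : ∀ {x z} → x ≗ z → signedEGF x ≈ˣ signedEGF z
  signedEGF-cong x≗z k = ι-cong (≡.cong ((-1ℤ ℤ.^ k) /! k ℚ.*_) (x≗z k))

  -- In (-x)ᵏ/k! the derivative lowers the index at the cost of a sign, hence the scalar `sign 1`.
  signedEGF-suc : ∀ z → signedEGF (z ∘ suc) ≈ˣ sign 1 ·ˣ ∂ˣ (signedEGF z)
  signedEGF-suc z n = begin
    ι ((-1ℤ ℤ.^ n) /! n ℚ.* z (suc n))
      ≈⟨ ι-cong (≡.cong (ℚ._* z (suc n)) (/!-suc (-1ℤ ℤ.^ n) n)) ⟨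
    ι (sign 1 ℚ.* (s ℚ.* a) ℚ.* z (suc n))
      ≈⟨ ι-cong (≡.trans (ℚ.*-assoc (sign 1) (s ℚ.* a) (z (suc n))) (≡.cong (sign 1 ℚ.*_) (ℚ.*-assoc s a (z (suc n))))) ⟩
    ι (sign 1 ℚ.* (s ℚ.* (a ℚ.* z (suc n))))
      ≈⟨ trans (*-homo _ _) (*-congˡ (*-homo _ _)) ⟩
    (sign 1 ·ˣ ∂ˣ (signedEGF z)) n
      ∎
    where
    s = + suc n / 1
    a = (-1ℤ ℤ.^ suc n) /! suc n

  signedEGF-shift : ∀ k z → signedEGF (λ j → z (k ℕ.+ j)) ≈ˣ sign k ·ˣ ∂ˣ^ k (signedEGF z)
  signedEGF-shift zero    z n = sym (trans (*-congʳ 1#-homo) (*-identityˡ _))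
  signedEGF-shift (suc k) z n = begin
    signedEGF (λ j → z (suc k ℕ.+ j)) n
      ≈⟨ signedEGF-cong (λ j → ≡.cong z (≡.sym (ℕ.+-suc k j))) n ⟩
    signedEGF (λ j → z (k ℕ.+ suc j)) n
      ≈⟨ signedEGF-suc (λ j → z (k ℕ.+ j)) n ⟩
    (sign 1 ·ˣ ∂ˣ (signedEGF λ j → z (k ℕ.+ j))) n
      ≈⟨ *-congˡ (∂ˣ-cong (signedEGF-shift k z) n) ⟩
    (sign 1 ·ˣ ∂ˣ (sign k ·ˣ ∂ˣ^ k (signedEGF z))) n
      ≈⟨ *-congˡ (∂ˣ-·ˣ (sign k) (∂ˣ^ k (signedEGF z)) n) ⟩
    (sign 1 ·ˣ (sign k ·ˣ ∂ˣ^ (suc k) (signedEGF z))) n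
      ≈⟨ ·ˣ-·ˣ (sign 1) (sign k) (∂ˣ^ (suc k) (signedEGF z)) n ⟩
    ((sign 1 ℚ.* sign k) ·ˣ ∂ˣ^ (suc k) (signedEGF z)) n
      ≈⟨ *-congʳ (ι-cong (≡.sym (/1-homo-* -1ℤ (-1ℤ ℤ.^ k)))) ⟩
    (sign (suc k) ·ˣ ∂ˣ^ (suc k) (signedEGF z)) n
      ∎

  signedEGF-* : ∀ x z → signedEGF (λ n → ∑[i+j≡ n ] λ i j → (+ (n C i) / 1) ℚ.* x i ℚ.* z j) ≈ˣ signedEGF x *ˣ signedEGF z
  signedEGF-* x z n = begin
    ι (a n ℚ.* ∑[i+j≡ n ] (λ i j → binom i ℚ.* x i ℚ.* z j))
      ≈⟨ ι-cong (≡.trans (ℚΣ.*-distribˡ-∑ n (a n) (λ i j → binom i ℚ.* x i ℚ.* z j)) (ℚΣ.∑-congᵢ n term)) ⟩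
    ι (∑[i+j≡ n ] (λ i j → (a i ℚ.* x i) ℚ.* (a j ℚ.* z j)))
      ≈⟨ ι-∑ n _ ⟩
    antidiagonalSum _+_ n (λ i j → ι ((a i ℚ.* x i) ℚ.* (a j ℚ.* z j)))
      ≈⟨ ∑-cong n (λ i j → *-homo (a i ℚ.* x i) (a j ℚ.* z j)) ⟩
    (signedEGF x *ˣ signedEGF z) n
      ∎
    where
    module ℚΣ = CauchyProduct ℚ.+-*-commutativeRing
    a : ℕ → ℚ
    a k = (-1ℤ ℤ.^ k) /! k
    binom : ℕ → ℚ
    binom i = + (n C i) / 1
    term : ∀ i j → i ℕ.+ j ≡ n → a n ℚ.* (binom i ℚ.* x i ℚ.* z j) ≡ (a i ℚ.* x i) ℚ.* (a j ℚ.* z j)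
    term i j refl = ≡.trans
      (solve 4 (λ a c x z → a :* (c :* x :* z) := a :* c :* (x :* z)) refl (a n) (binom i) (x i) (z j))
      (≡.trans (≡.cong (ℚ._* (x i ℚ.* z j)) (binomial-/! i j))
        (solve 4 (λ a b x z → a :* b :* (x :* z) := a :* x :* (b :* z)) refl (a i) (a j) (x i) (z j)))
      where open ℚ.+-*-Solver

  𝔥-∷ʳ : ∀ ks k → 𝔥 B (ks ∷ʳ k) ≈ˣ sign k ·ˣ (𝔥 B [] *ˣ ∂ˣ^ k (𝔥 B ks))
  𝔥-∷ʳ ks k n = begin
    𝔥 B (ks ∷ʳ k) n
      ≈⟨ signedEGF-cong (ζ-EMS-recursion ks k) n ⟩
    signedEGF (λ n → ∑[i+j≡ n ] λ i j → (+ (n C i) / 1) ℚ.* ζ-EMS B (i ∷ []) ℚ.* ζ-EMS B (ks ∷ʳ (k ℕ.+ j))) n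
      ≈⟨ signedEGF-* (λ i → ζ-EMS B (i ∷ [])) (λ j → ζ-EMS B (ks ∷ʳ (k ℕ.+ j))) n ⟩
    (𝔥 B [] *ˣ signedEGF (λ j → ζ-EMS B (ks ∷ʳ (k ℕ.+ j)))) n
      ≈⟨ *ˣ-cong (𝔥 B []) (signedEGF-shift k (λ j → ζ-EMS B (ks ∷ʳ j))) n ⟩
    (𝔥 B [] *ˣ (sign k ·ˣ ∂ˣ^ k (𝔥 B ks))) n
      ≈⟨ *ˣ-·ˣ (sign k) (𝔥 B []) (∂ˣ^ k (𝔥 B ks)) n ⟩
    (sign k ·ˣ (𝔥 B [] *ˣ ∂ˣ^ k (𝔥 B ks))) n
      ∎

  sign-sum-∷ʳ : ∀ ks k → sign k ℚ.* sign (sum ks) ≡ sign (sum (ks ∷ʳ k))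
  sign-sum-∷ʳ ks k = ≡.trans (≡.sym (/1-homo-* (-1ℤ ℤ.^ k) (-1ℤ ℤ.^ sum ks))) (≡.cong (_/ 1) (≡.trans
    (≡.sym (ℤ.^-distribˡ-+-* -1ℤ k (sum ks)))
    (≡.cong (-1ℤ ℤ.^_) (≡.trans (ℕ.+-comm k (sum ks))
      (≡.trans (≡.cong (sum ks ℕ.+_) (≡.sym (ℕ.+-identityʳ k))) (≡.sym (sum-++ ks [ k ])))))))

  -- The induction runs from the right end of the list: `𝔥-∷ʳ` removes the last entry, and `foldl`
  -- applies it as the outermost operator. The accumulated sign is a scalar and moves past
  -- derivatives and products.
  𝔥≈𝔥∂ : ∀ ks → 𝔥 B ks ≈ˣ sign (sum ks) ·ˣ 𝔥∂ B ks
  𝔥≈𝔥∂ ks = go (reverseView ks)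
    where
    go : ∀ {ks} → Reverse ks → 𝔥 B ks ≈ˣ sign (sum ks) ·ˣ 𝔥∂ B ks
    go []               n = sym (trans (*-congʳ 1#-homo) (*-identityˡ _))
    go (ks ∶ rs ∶ʳ k) n = begin
      𝔥 B (ks ∷ʳ k) n
        ≈⟨ 𝔥-∷ʳ ks k n ⟩
      (sign k ·ˣ (𝔥 B [] *ˣ ∂ˣ^ k (𝔥 B ks))) n
        ≈⟨ *-congˡ (*ˣ-cong (𝔥 B []) (∂ˣ^-cong k (go rs)) n) ⟩
      (sign k ·ˣ (𝔥 B [] *ˣ ∂ˣ^ k (s ·ˣ 𝔥∂ B ks))) n
        ≈⟨ *-congˡ (*ˣ-cong (𝔥 B []) (∂ˣ^-·ˣ k s (𝔥∂ B ks)) n) ⟩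
      (sign k ·ˣ (𝔥 B [] *ˣ (s ·ˣ ∂ˣ^ k (𝔥∂ B ks)))) n
        ≈⟨ *-congˡ (*ˣ-·ˣ s (𝔥 B []) (∂ˣ^ k (𝔥∂ B ks)) n) ⟩
      (sign k ·ˣ (s ·ˣ (𝔥 B [] *ˣ ∂ˣ^ k (𝔥∂ B ks)))) n
        ≈⟨ ·ˣ-·ˣ (sign k) s (𝔥 B [] *ˣ ∂ˣ^ k (𝔥∂ B ks)) n ⟩
      ((sign k ℚ.* s) ·ˣ (𝔥 B [] *ˣ ∂ˣ^ k (𝔥∂ B ks))) n
        ≡⟨ ≡.cong₂ (λ a f → (a ·ˣ f) n) (sign-sum-∷ʳ ks k)
             (≡.sym (foldl-∷ʳ (λ g k → 𝔥 B [] *ˣ ∂ˣ^ k g) (𝔥 B []) k ks)) ⟩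
      (sign (sum (ks ∷ʳ k)) ·ˣ 𝔥∂ B (ks ∷ʳ k)) n
        ∎
      where s = sign (sum ks)

proposition3p3 : ∀ {c ℓ} (K : CommutativeRing c ℓ) (ι : ℚ → CommutativeRing.Carrier K) →
    IsRingHomomorphism ℚ.+-*-rawRing (CommutativeRing.rawRing K) ι →
    (B : Birkhoff) (ks : List ℕ) (kₙ₋₁ : ℕ) →
    (∀ kₙ → ζ-EMS B (ks ∷ʳ kₙ₋₁ ∷ʳ kₙ)
    ≡ ∑[i+j≡ kₙ ] (λ i j → (+ (kₙ C i) / 1) ℚ.* ζ-EMS B (i ∷ []) ℚ.* ζ-EMS B (ks ∷ʳ (kₙ₋₁ ℕ.+ j))))
    × (let open PowerSeries K ι in
    𝔥 B (ks ∷ʳ kₙ₋₁) ≈ˣ ((-1ℤ ℤ.^ sum (ks ∷ʳ kₙ₋₁)) / 1) ·ˣ 𝔥∂ B (ks ∷ʳ kₙ₋₁))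
proposition3p3 K ι ι-homo B ks kₙ₋₁ =
  ZetaValues.ζ-EMS-recursion B ks kₙ₋₁ , GeneratingFunctions.𝔥≈𝔥∂ K ι ι-homo B (ks ∷ʳ kₙ₋₁)
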